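{- Let $n\ge 1$, let $\Phi=\{f_1,\ldots,f_k\}$ be a finite subset of the free MV-algebra $\mathbf{F}_n$ and let $\beta:\Phi\to[0,1]\cap\mathbb{Q}$ be a rational-valued book on $\Phi$. Let $\Pi_\Phi$, $\Pi_{(\mathrm{rb}\,\Phi)}$ and $\Pi_\beta$ be the formulas of $Ł(k)$ computed by the procedure $\Pi$, axiomatizing respectively the theories $\Theta_{\mathscr{C}_\Phi}$, $\Theta_{(\mathrm{rb}\,\mathscr{C}_\Phi)}$ and $\Theta_{\beta}$. Then the following conditions hold: (1) $\beta$ is coherent if and only if there exists a non-zero $m\in\mathbb{N}$ such that $\vdash(\Pi_\beta)^m\to\Pi_\Phi$. (2) $\beta$ is strictly coherent if and only if there exists a non-zero $m\in\mathbb{N}$ such that $\vdash(\Pi_\beta)^m\to\Pi_\Phi$ and, for all non-zero $m\in\mathbb{N}$, $\not\vdash(\Pi_\beta)^m\to\Pi_{(\mathrm{rb}\,\Phi)}$.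
   Context: $\mathbf{F}_n$ is the free $n$-generated MV-algebra, identified with the algebra of all $n$-variable McNaughton functions: continuous functions $f:[0,1]^n\to[0,1]$ that are piecewise linear (affine) with finitely many pieces, each with integer coefficients, under pointwise operations. Books. A book on $\Phi=\{f_1,\ldots,f_k\}$ is a map $\beta:\Phi\to[0,1]$, identified with the point $\langle\beta(f_1),\ldots,\beta(f_k)\rangle\in[0,1]^k$. It is coherent if there are no $\sigma_1,\ldots,\sigma_k\in\mathbb{R}$ with $\sum_i\sigma_i(\beta(f_i)-f_i(x))<0$ for every $x\in[0,1]^n$. It is strictly coherent if for all $\sigma_1,\ldots,\sigma_k\in\mathbb{R}$, the existence of $x\in[0,1]^n$ with $\sum_i\sigma_i(\beta(f_i)-f_i(x))<0$ implies the existence of $x'\in[0,1]^n$ with $\sum_i\sigma_i(\beta(f_i)-f_i(x'))>0$. Geometry. $\mathscr{C}_\Phi$ is the closure of the convex hull of $\{\langle f_1(x),\ldots,f_k(x)\rangle\mid x\in[0,1]^n\}$ in $\mathbb{R}^k$; it is a polytope with rational vertices. $\mathrm{rb}\,\mathscr{C}_\Phi$ is its relative boundary (a finite union of rational polytopes, possibly empty). Logic. $Ł(k)$ is the set of formulas of propositional Łukasiewicz logic in $k$ variables, with primitive connectives $\neg,\to$ and defined connectives $\varphi\oplus\psi=\neg\varphi\to\psi$, $\varphi\odot\psi=\neg(\neg\varphi\oplus\neg\psi)$, $\varphi\vee\psi=(\varphi\to\psi)\to\psi$. Axioms: $\varphi\to(\psi\to\varphi)$; $(\varphi\to\psi)\to((\psi\to\chi)\to(\varphi\to\chi))$;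 $((\varphi\to\psi)\to\psi)\to((\psi\to\varphi)\to\varphi)$; $(\neg\varphi\to\neg\psi)\to(\psi\to\varphi)$; the only rule is modus ponens. $\vdash\varphi$ means $\varphi$ is derivable. $\psi^m$ denotes $\psi\odot\cdots\odot\psi$ ($m$ times). Each $\psi\in Ł(k)$ determines the McNaughton function $f_\psi:[0,1]^k\to[0,1]$ obtained by interpreting $\neg x=1-x$, $x\to y=\min\{1,1-x+y\}$. A theory is a deductively closed set of formulas; a formula $\theta$ axiomatizes a theory $\Theta$ of $Ł(k)$ if $\Theta$ is the smallest theory of $Ł(k)$ containing $\theta$. For a rational polyhedron $\mathscr{P}\subseteq[0,1]^k$ (a finite union, possibly empty, of convex hulls of finitely many rational points), $\Theta_{\mathscr{P}}=\{\psi\in Ł(k)\mid f_\psi(x)=1\text{ for all }x\in\mathscr{P}\}$; and $\Theta_\beta=\Theta_{\{\beta\}}$. Procedure. $\Pi$ is a fixed effective procedure which, for each finite $\Phi=\{f_1,\ldots,f_k\}\subseteq\mathbf{F}_n$ and each rational $\beta\in[0,1]^k$, computes formulas $\Pi_\Phi,\Pi_{(\mathrm{rb}\,\Phi)},\Pi_\beta\in Ł(k)$ axiomatizing $\Theta_{\mathscr{C}_\Phi}$, $\Theta_{(\mathrm{rb}\,\mathscr{C}_\Phi)}$ and $\Theta_\beta$ respectively. -}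

module Defs where

open import Level using (0ℓ; suc)
open import Algebra.Bundles using (CommutativeRing)
open import Algebra.Structures using (IsCommutativeRing)
import Algebra.Definitions.RawMonoid as RawMonoidDefinitions
import Algebra.Construct.NaturalChoice.Min as Minimum
open import Data.Fin.Base using (Fin)
open import Data.Integer.Base using (ℤ; +_; -[1+_])
open import Data.Nat.Base as ℕ using (ℕ)
open import Data.Product.Base using (Σ; ∃; ∃-syntax; _×_; _,_)
open import Data.Rational.Base using (ℚ; ↥_; ↧_)
open import Data.Vec.Functional using (Vector)
open import Relation.Binary.Bundles using (TotalOrder)
open import Relation.Binary.Core using (Rel)
import Relation.Binary.Construct.NonStrictToStrict as ToStrict
open import Relation.Binary.PropositionalEquality.Core using (_≡_)
open import Relation.Binary.Structures using (IsTotalOrder)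
open import Relation.Nullary.Negation.Core using (¬_)
open import Relation.Unary using (Pred; _∈_; _∉_; _⊆_; ∅)

infixr 5 _⇒_
infix  8 ~_

data Formula (k : ℕ) : Set where
  var : Fin k → Formula k
  ~_  : Formula k → Formula k
  _⇒_ : Formula k → Formula k → Formula k

module _ {k : ℕ} where

  infixr 6 _⊕_
  infixr 7 _⊙_
  infix  9 _^_

  _⊕_ _⊙_ : Formula k → Formula k → Formula k
  φ ⊕ ψ = ~ φ ⇒ ψ
  φ ⊙ ψ = ~ (~ φ ⊕ ~ ψ)

  -- ψ ^ m is ψ ⊙ ⋯ ⊙ ψ with m factors, so that ψ ^ 1 is ψ itself.  There are
  -- no constants in the language; the empty product is a tautology.
  _^_ : Formula k → ℕ → Formula k
  ψ ^ 0                   = ψ ⇒ ψ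
  ψ ^ 1                   = ψ
  ψ ^ ℕ.suc m@(ℕ.suc _)   = ψ ⊙ (ψ ^ m)

  data Axiom : Pred (Formula k) 0ℓ where
    Ł1 : ∀ φ ψ   → Axiom (φ ⇒ (ψ ⇒ φ))
    Ł2 : ∀ φ ψ χ → Axiom ((φ ⇒ ψ) ⇒ ((ψ ⇒ χ) ⇒ (φ ⇒ χ)))
    Ł3 : ∀ φ ψ   → Axiom (((φ ⇒ ψ) ⇒ ψ) ⇒ ((ψ ⇒ φ) ⇒ φ))
    Ł4 : ∀ φ ψ   → Axiom ((~ φ ⇒ ~ ψ) ⇒ (ψ ⇒ φ))

  infix 3 _⊩_ ⊢_

  data _⊩_ (Γ : Pred (Formula k) 0ℓ) : Pred (Formula k) 0ℓ where
    hyp : ∀ {φ}   → φ ∈ Γ → Γ ⊩ φ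
    ax  : ∀ {φ}   → Axiom φ → Γ ⊩ φ
    mp  : ∀ {φ ψ} → Γ ⊩ φ → Γ ⊩ φ ⇒ ψ → Γ ⊩ ψ

  ⊢_ : Pred (Formula k) 0ℓ
  ⊢ φ = ∅ ⊩ φ

  Theory : Pred (Formula k) 0ℓ → Set
  Theory Θ = ∀ {φ} → Θ ⊩ φ → φ ∈ Θ

  Axiomatizes : Formula k → Pred (Formula k) 0ℓ → Set₁
  Axiomatizes θ Θ = Theory Θ × θ ∈ Θ × (∀ T → Theory T → θ ∈ T → Θ ⊆ T)

-- The real line is specified by its categorical axioms, those of a Dedekind
-- complete ordered field (which, classically, determine it up to a unique
-- isomorphism).  As usual the inverse is total; its value at 0# is unspecified.
record CompleteOrderedField : Set (suc 0ℓ) where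
  infix  4 _≈_ _≤_
  infixl 6 _+_
  infixl 7 _*_
  infix  8 -_
  infix  9 _⁻¹
  field
    Carrier           : Set
    _≈_               : Rel Carrier 0ℓ
    _≤_               : Rel Carrier 0ℓ
    _+_ _*_           : Carrier → Carrier → Carrier
    -_ _⁻¹            : Carrier → Carrier
    0# 1#             : Carrier
    isCommutativeRing : IsCommutativeRing _≈_ _+_ _*_ -_ 0# 1#
    1≉0               : ¬ 1# ≈ 0#
    *-inverseʳ        : ∀ x → ¬ x ≈ 0# → x * x ⁻¹ ≈ 1#
    isTotalOrder      : IsTotalOrder _≈_ _≤_
    +-monoʳ-≤         : ∀ x {y z} → y ≤ z → x + y ≤ x + z
    *-nonNegative     : ∀ {x y} → 0# ≤ x → 0# ≤ y → 0# ≤ x * y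

  UpperBound : Pred Carrier 0ℓ → Pred Carrier 0ℓ
  UpperBound S b = ∀ {x} → x ∈ S → x ≤ b

  field
    supremum : (S : Pred Carrier 0ℓ) → (∃[ x ] x ∈ S) → (∃[ b ] b ∈ UpperBound S) →
               ∃[ s ] s ∈ UpperBound S × (∀ b → b ∈ UpperBound S → s ≤ b)

  commutativeRing : CommutativeRing 0ℓ 0ℓ
  commutativeRing = record { isCommutativeRing = isCommutativeRing }

  totalOrder : TotalOrder 0ℓ 0ℓ 0ℓ
  totalOrder = record { isTotalOrder = isTotalOrder }

  open CommutativeRing commutativeRing public using (_-_; +-rawMonoid)
  open ToStrict _≈_ _≤_ public using (_<_)
  open Minimum totalOrder public using (_⊓_)
  open RawMonoidDefinitions +-rawMonoid public using (sum) renaming (_×_ to _·_)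

  fromℤ : ℤ → Carrier
  fromℤ (+ n)    = n · 1#
  fromℤ -[1+ n ] = - (ℕ.suc n · 1#)

  fromℚ : ℚ → Carrier
  fromℚ q = fromℤ (↥ q) * fromℤ (↧ q) ⁻¹

module Books (ℝ : CompleteOrderedField) where

  infix 4 _≈ₚ_ _≈ᶠ_

  open CompleteOrderedField ℝ

  Point : ℕ → Set
  Point k = Vector Carrier k

  _≈ₚ_ : ∀ {k} → Rel (Point k) 0ℓ
  x ≈ₚ y = ∀ i → x i ≈ y i

  record Cube (n : ℕ) : Set where
    constructor cube
    field
      pt  : Point n
      0≤  : ∀ i → 0# ≤ pt i
      ≤1  : ∀ i → pt i ≤ 1#

  open Cube public using (pt)

  Within : Carrier → Carrier → Carrier → Set
  Within ε x y = x - y < ε × y - x < ε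

  -- The maximum distance, which induces the Euclidean topology.
  Near : ∀ {k} → Carrier → Point k → Point k → Set
  Near ε x y = ∀ i → Within ε (x i) (y i)

  Continuous : ∀ {n} → (Cube n → Carrier) → Set
  Continuous f = ∀ x ε → 0# < ε →
    ∃[ δ ] 0# < δ × (∀ y → Near δ (pt x) (pt y) → Within ε (f x) (f y))

  record Affineℤ (n : ℕ) : Set where
    constructor affine
    field
      coefficient : Fin n → ℤ
      constant    : ℤ

    eval : Point n → Carrier
    eval x = sum (λ i → fromℤ (coefficient i) * x i) + fromℤ constant

  PiecewiseLinear : ∀ {n} → (Cube n → Carrier) → Set
  PiecewiseLinear {n} f = ∃[ m ] Σ (Fin m → Affineℤ n) λ p →
    ∀ x → ∃[ j ] f x ≈ Affineℤ.eval (p j) (pt x)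

  record 𝐅 (n : ℕ) : Set where
    field
      fn              : Cube n → Carrier
      0≤fn            : ∀ x → 0# ≤ fn x
      fn≤1            : ∀ x → fn x ≤ 1#
      continuous      : Continuous fn
      piecewiseLinear : PiecewiseLinear fn

  open 𝐅 public using (fn)

  _≈ᶠ_ : ∀ {n} → Rel (𝐅 n) 0ℓ
  f ≈ᶠ g = ∀ x → fn f x ≈ fn g x

  -- A finite set Φ = {f₁,…,f_k} is given by an enumeration without
  -- repetitions, and a book on Φ is the corresponding point of [0,1]^k.

  module _ {n k : ℕ} (Φ : Fin k → 𝐅 n) (β : Cube k) where

    balance : Vector Carrier k → Cube n → Carrier
    balance σ x = sum λ i → σ i * (pt β i - fn (Φ i) x)

    Coherent : Set
    Coherent = ¬ (∃[ σ ] ∀ x → balance σ x < 0#)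

    StrictlyCoherent : Set
    StrictlyCoherent = ∀ σ →
      (∃[ x ] balance σ x < 0#) → (∃[ x′ ] 0# < balance σ x′)

  Rational : ∀ {k} → Pred (Cube k) 0ℓ
  Rational β = ∀ i → ∃[ q ] pt β i ≈ fromℚ q

  module _ {k : ℕ} where

    IsAffineCombination : ∀ {m} → Vector Carrier m → Vector (Point k) m → Pred (Point k) 0ℓ
    IsAffineCombination t p y = sum t ≈ 1# × (y ≈ₚ λ i → sum λ j → t j * p j i)

    affineHull convexHull : Pred (Point k) 0ℓ → Pred (Point k) 0ℓ
    affineHull S y = ∃[ m ] Σ (Vector Carrier m) λ t → Σ (Vector (Point k) m) λ p →
      (∀ j → p j ∈ S) × IsAffineCombination t p y
    convexHull S y = ∃[ m ] Σ (Vector Carrier m) λ t → Σ (Vector (Point k) m) λ p →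
      (∀ j → 0# ≤ t j) × (∀ j → p j ∈ S) × IsAffineCombination t p y

    closure relativeInterior relativeBoundary : Pred (Point k) 0ℓ → Pred (Point k) 0ℓ
    closure S y = ∀ ε → 0# < ε → ∃[ z ] z ∈ S × Near ε y z
    relativeInterior S y = y ∈ S ×
      ∃[ ε ] 0# < ε × (∀ z → z ∈ affineHull S → Near ε y z → z ∈ S)
    relativeBoundary S y = y ∈ closure S × y ∉ relativeInterior S

    singleton : Point k → Pred (Point k) 0ℓ
    singleton β x = x ≈ₚ β

  module _ {n k : ℕ} (Φ : Fin k → 𝐅 n) where

    range 𝒞 rb𝒞 : Pred (Point k) 0ℓ
    range y = ∃[ x ] y ≈ₚ λ i → fn (Φ i) x
    𝒞       = closure (convexHull range)
    rb𝒞     = relativeBoundary 𝒞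

  ⟦_⟧ : ∀ {k} → Formula k → Cube k → Carrier
  ⟦ var i ⟧ x = pt x i
  ⟦ ~ φ   ⟧ x = 1# - ⟦ φ ⟧ x
  ⟦ φ ⇒ ψ ⟧ x = 1# ⊓ (1# - ⟦ φ ⟧ x + ⟦ ψ ⟧ x)

  Th : ∀ {k} → Pred (Point k) 0ℓ → Pred (Formula k) 0ℓ
  Th P ψ = ∀ x → pt x ∈ P → ⟦ ψ ⟧ x ≈ 1#

{-# OPTIONS --safe #-}
module Submission where

-- By the local deduction theorem, θ ⊩ φ means ⊢ θᵐ → φ for some m, so the derivability of (Π_β)ᵐ →
-- Π_P for some m says that Θ_P ⊆ Θ_β. For closed P this means β ∈ P: if β ∉ P, then formulas in
-- one variable that pass from 0 to 1 on a short interval combine to one that is 0 at β and 1 on P.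
-- It remains to see that β is coherent iff β ∈ 𝒞 and strictly coherent iff β lies in the relative
-- interior of 𝒞. Both come from one alternative, proved by induction on the dimension: a convex
-- cone is a linear space or has a nonnegative functional that is not identically zero on it.
-- Applied to the cone generated by the vectors β − f(x), it turns strict coherence into the
-- absence of a proper supporting hyperplane at β; applied to the cone over their ε-neighbourhood,
-- it separates β from 𝒞. Conversely, a strictly losing combination of bets loses a uniform amount
-- by compactness of the cube, which excludes β ∈ 𝒞.

open import Defs
open import Level using (0ℓ)
open import Algebra.Bundles using (CommutativeRing)
import Algebra.Construct.NaturalChoice.Min as Minimum
import Algebra.Construct.NaturalChoice.MinOp as MinOp
import Algebra.Properties.Ring as RingProperties
import Algebra.Properties.Semiring.Mult.TCOptimised as Multiples
import Algebra.Solver.Ring as RingSolver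
open import Algebra.Solver.Ring.AlmostCommutativeRing
  using (fromCommutativeRing; _-Raw-AlmostCommutative⟶_)
open import Axiom.ExcludedMiddle using (ExcludedMiddle)
open import Data.Empty using (⊥; ⊥-elim)
open import Data.Fin.Base using (Fin; zero; suc)
open import Data.Integer.Base as ℤ using (ℤ)
import Data.Integer.Properties as ℤₚ
open import Data.Maybe.Base using (Maybe; map)
open import Data.Nat.Base as ℕ using (ℕ; zero; suc; NonZero) renaming (_≤_ to _≤ℕ_)
import Data.Nat.Properties as ℕₚ
open import Data.Product.Base using (Σ; _×_; ∃-syntax; _,_; proj₁; proj₂)
import Data.Sign.Base as Sign
open import Data.Sum.Base using (_⊎_; inj₁; inj₂)
open import Data.Vec.Functional using (Vector; _∷_; []; tail)
open import Function.Base using (_∘_)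
open import Function.Bundles using (_⇔_; mk⇔)
open import Function.Definitions using (Injective)
import Relation.Binary.Construct.NonStrictToStrict as ToStrict
open import Relation.Binary.PropositionalEquality.Core as ≡ using (_≡_)
open import Relation.Binary.Structures using (IsTotalOrder)
open import Relation.Nullary.Decidable.Core using (Dec; yes; no; decidable-stable; dec⇒maybe)
open import Relation.Nullary.Negation.Core using (¬_)
open import Relation.Unary using (Pred; _∈_; _∉_; _⊆_; _∪_)

-- A point of the convex hull is a conic combination of total weight 1, but membership in a cone
-- forgets the weight. Cones are therefore relations between a weight and a vector. If the cone
-- generated by the β - f(x) is a linear space, it represents 0 with every nonnegative weight, so
-- weights can be raised to 1; and it represents a vector of size r with weight at most M r, so
-- weight at most 1 suffices near 0. Together these lead from the linear space back to the hull. The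
-- alternative for cones only yields a functional that may vanish on some generators, whereas
-- incoherence demands a strict loss at every point of the cube; the ε-neighbourhood supplies this
-- strictness. In the logic, the lack of contraction forces every use of θ to be counted, and the
-- count becomes the exponent m.

-- Derivations in Łukasiewicz logic and the local deduction theorem.

module Deduction {k : ℕ} where

  private variable
    Γ       : Pred (Formula k) 0ℓ
    φ ψ χ θ : Formula k

  ⊩-trans : Γ ⊩ φ ⇒ ψ → Γ ⊩ ψ ⇒ χ → Γ ⊩ φ ⇒ χ
  ⊩-trans p q = mp q (mp p (ax (Ł2 _ _ _)))

  ⊩-const : Γ ⊩ φ → Γ ⊩ ψ ⇒ φ
  ⊩-const p = mp p (ax (Ł1 _ _))

  -- Read (φ ⇒ ψ) ⇒ ψ as φ ∨ ψ: weakening gives ψ ∨ φ, and Ł3 is commutativity of ∨.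
  assertion : Γ ⊩ φ ⇒ ((φ ⇒ ψ) ⇒ ψ)
  assertion = ⊩-trans (ax (Ł1 _ _)) (ax (Ł3 _ _))

  -- Ł2 turns the premise into ((ψ ⇒ χ) ⇒ χ) ⇒ (φ ⇒ χ), and `assertion` supplies the antecedent from
  -- ψ.
  exchange : Γ ⊩ (φ ⇒ (ψ ⇒ χ)) ⇒ (ψ ⇒ (φ ⇒ χ))
  exchange = ⊩-trans (ax (Ł2 _ _ _)) (mp assertion (ax (Ł2 _ _ _)))

  ⊩-swap : Γ ⊩ φ ⇒ (ψ ⇒ χ) → Γ ⊩ ψ ⇒ (φ ⇒ χ)
  ⊩-swap p = mp p exchange

  ⇒-refl : Γ ⊩ φ ⇒ φ
  ⇒-refl {φ = φ} = mp (ax (Ł1 φ φ)) (⊩-swap (ax (Ł1 _ _)))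

  ⇒-monoʳ : Γ ⊩ (φ ⇒ ψ) ⇒ ((θ ⇒ φ) ⇒ (θ ⇒ ψ))
  ⇒-monoʳ = ⊩-swap (ax (Ł2 _ _ _))

  -- Ł1 followed by Ł4 twice leads from ~ ~ φ to θ ⇒ φ for any θ; the derivable formula φ ⇒ φ is
  -- taken for θ and then discharged.
  ~~-elim : Γ ⊩ ~ ~ φ ⇒ φ
  ~~-elim {φ = φ} = mp (⇒-refl {φ = φ})
    (⊩-swap (⊩-trans (⊩-trans (ax (Ł1 _ _)) (ax (Ł4 _ _))) (ax (Ł4 _ _))))

  ~~-intro : Γ ⊩ φ ⇒ ~ ~ φ
  ~~-intro = mp ~~-elim (ax (Ł4 _ _))

  contraposition : Γ ⊩ (φ ⇒ ψ) ⇒ (~ ψ ⇒ ~ φ)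
  contraposition =
    ⊩-trans (⊩-trans (mp ~~-elim (ax (Ł2 _ _ _))) (mp ~~-intro ⇒-monoʳ)) (ax (Ł4 _ _))

  -- φ ⊙ ψ unfolds to ~ (~ ~ φ ⇒ ~ ψ). Contraposing ψ ⇒ χ and exchanging gives ~ χ ⇒ (φ ⇒ ~ ψ),
  -- whose contrapositive is the goal up to double negations.
  residuation : Γ ⊩ (φ ⇒ (ψ ⇒ χ)) ⇒ (φ ⊙ ψ ⇒ χ)
  residuation =
    ⊩-trans (mp contraposition ⇒-monoʳ)
    (⊩-trans exchange
    (⊩-trans (mp (mp ~~-elim (ax (Ł2 _ _ _))) ⇒-monoʳ)
    (⊩-trans contraposition (mp ~~-elim ⇒-monoʳ))))

  -- The curried form of θ ^ m ⇒ φ. In this form modus ponens just adds lengths, and ⊙ enters only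
  -- in `iterate⇒^`.
  iterate : Formula k → ℕ → Formula k → Formula k
  iterate θ zero    φ = φ
  iterate θ (suc m) φ = θ ⇒ iterate θ m φ

  iterate-mono : ∀ m → Γ ⊩ (φ ⇒ ψ) ⇒ (iterate θ m φ ⇒ iterate θ m ψ)
  iterate-mono zero    = ⇒-refl
  iterate-mono (suc m) = ⊩-trans (iterate-mono m) ⇒-monoʳ

  iterate-+ : ∀ m n → iterate θ m (iterate θ n φ) ≡ iterate θ (m ℕ.+ n) φ
  iterate-+         zero    n = ≡.refl
  iterate-+ {θ = θ} (suc m) n = ≡.cong (θ ⇒_) (iterate-+ m n)

  iterate-mp : ∀ m n → Γ ⊩ iterate θ m φ → Γ ⊩ iterate θ n (φ ⇒ ψ) → Γ ⊩ iterate θ (n ℕ.+ m) ψ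
  iterate-mp {Γ = Γ} m n p q =
    ≡.subst (Γ ⊩_) (iterate-+ n m) (mp q (mp (mp p (⊩-swap (iterate-mono m))) (iterate-mono n)))

  iterate⇒^ : ∀ m → Γ ⊩ iterate θ (suc m) φ ⇒ (θ ^ suc m ⇒ φ)
  iterate⇒^ zero    = ⇒-refl
  iterate⇒^ (suc m) = ⊩-trans (mp (iterate⇒^ m) ⇒-monoʳ) residuation

  -- Each modus ponens adds the numbers of uses of θ in its two premises. An axiom is weakened by
  -- one θ as well, so that the count is always positive.
  deduction : (_≡ θ) ⊩ φ → ∃[ m ] ⊢ iterate θ (suc m) φ
  deduction (hyp ≡.refl) = 0 , ⇒-refl
  deduction (ax a)     = 0 , ⊩-const (ax a)
  deduction (mp p q) with deduction p | deduction q
  ... | m , ⊢φ | n , ⊢φ⇒ψ = n ℕ.+ suc m , iterate-mp (suc m) (suc n) ⊢φ ⊢φ⇒ψ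

  local-deduction : (_≡ θ) ⊩ φ → ∃[ m ] (NonZero m × (⊢ θ ^ m ⇒ φ))
  local-deduction p with deduction p
  ... | m , ⊢φ = suc m , _ , mp ⊢φ (iterate⇒^ m)

  -- The consequences of θ form a theory containing θ, so the minimality of Θ applies to them.
  axiomatizes⇒⊩ : ∀ {Θ} → Axiomatizes θ Θ → Θ ⊆ ((_≡ θ) ⊩_)
  axiomatizes⇒⊩ {θ = θ} (_ , _ , least) = least ((_≡ θ) ⊩_) cut (hyp ≡.refl)
    where
    cut : Theory ((_≡ θ) ⊩_)
    cut (hyp p)  = p
    cut (ax a)   = ax a
    cut (mp p q) = mp (cut p) (cut q)

-- Integer coefficients for the ring solver.

module IntegerCoefficients (R : CommutativeRing 0ℓ 0ℓ) where
  open CommutativeRing R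
  open import Data.Integer.Base using (+_; -[1+_]; _⊖_)
  open Multiples semiring renaming (_×_ to _·_)
  open RingProperties ring
  open import Relation.Binary.Reasoning.Setoid setoid

  -- With the optimised multiples the image of 1 computes to the unit of the ring, so `1ₚ` agrees
  -- with it definitionally in solver goals.
  ι : ℤ → Carrier
  ι (+ n)    = n · 1#
  ι -[1+ n ] = - (suc n · 1#)

  ι-⊖ : ∀ m n → ι (m ⊖ n) ≈ m · 1# - n · 1#
  ι-⊖ m       zero    = begin
    m · 1#        ≈⟨ +-identityʳ _ ⟨
    m · 1# + 0#   ≈⟨ +-congˡ -0#≈0# ⟨
    m · 1# - 0#   ∎
  ι-⊖ zero    (suc n) = sym (+-identityˡ _)
  ι-⊖ (suc m) (suc n) = begin
    ι (suc m ⊖ suc n)                        ≡⟨ ≡.cong ι (ℤₚ.[1+m]⊖[1+n]≡m⊖n m n) ⟩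
    ι (m ⊖ n)                                ≈⟨ ι-⊖ m n ⟩
    m · 1# - n · 1#                          ≈⟨ +-congʳ (+-identityˡ _) ⟨
    (0# + m · 1#) - n · 1#                   ≈⟨ +-congʳ (+-congʳ (-‿inverseʳ 1#)) ⟨
    ((1# - 1#) + m · 1#) - n · 1#            ≈⟨ +-congʳ (+-assoc _ _ _) ⟩
    (1# + (- 1# + m · 1#)) - n · 1#          ≈⟨ +-congʳ (+-congˡ (+-comm _ _)) ⟩
    (1# + (m · 1# - 1#)) - n · 1#            ≈⟨ +-congʳ (+-assoc _ _ _) ⟨
    ((1# + m · 1#) - 1#) - n · 1#            ≈⟨ +-assoc _ _ _ ⟩
    (1# + m · 1#) + (- 1# - n · 1#)          ≈⟨ +-congˡ (-‿+-comm _ _) ⟩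
    (1# + m · 1#) - (1# + n · 1#)            ≈⟨ +-cong (1+× m 1#) (-‿cong (1+× n 1#)) ⟨
    suc m · 1# - suc n · 1#                  ∎

  ι-+ : ∀ i j → ι (i ℤ.+ j) ≈ ι i + ι j
  ι-+ (+ m)    (+ n)    = ×-homo-+ 1# m n
  ι-+ (+ m)    -[1+ n ] = ι-⊖ m (suc n)
  ι-+ -[1+ m ] (+ n)    = trans (ι-⊖ n (suc m)) (+-comm _ _)
  ι-+ -[1+ m ] -[1+ n ] = begin
    - (suc (suc (m ℕ.+ n)) · 1#)           ≡⟨ ≡.cong (λ l → - (l · 1#)) (ℕₚ.+-suc (suc m) n) ⟨
    - ((suc m ℕ.+ suc n) · 1#)             ≈⟨ -‿cong (×-homo-+ 1# (suc m) (suc n)) ⟩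
    - (suc m · 1# + suc n · 1#)            ≈⟨ -‿+-comm _ _ ⟨
    - (suc m · 1#) - suc n · 1#            ∎

  ι-neg : ∀ i → ι (ℤ.- i) ≈ - ι i
  ι-neg (+ zero)    = sym -0#≈0#
  ι-neg (+ (suc n)) = refl
  ι-neg -[1+ n ]    = sym (-‿involutive _)

  ι-pos : ∀ n → ι (Sign.+ ℤ.◃ n) ≈ n · 1#
  ι-pos n = reflexive (≡.cong ι (ℤₚ.+◃n≡+n n))

  ι-negative : ∀ n → ι (Sign.- ℤ.◃ n) ≈ - (n · 1#)
  ι-negative n = trans (reflexive (≡.cong ι (ℤₚ.-◃n≡-n n))) (ι-neg (+ n))

  ι-* : ∀ i j → ι (i ℤ.* j) ≈ ι i * ι j
  ι-* (+ m)    (+ n)    = trans (ι-pos (m ℕ.* n)) (×1-homo-* m n)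
  ι-* (+ m)    -[1+ n ] =
    trans (ι-negative (m ℕ.* suc n)) (trans (-‿cong (×1-homo-* m (suc n))) (-‿distribʳ-* _ _))
  ι-* -[1+ m ] (+ n)    =
    trans (ι-negative (suc m ℕ.* n)) (trans (-‿cong (×1-homo-* (suc m) n)) (-‿distribˡ-* _ _))
  ι-* -[1+ m ] -[1+ n ] = begin
    ι (Sign.+ ℤ.◃ (suc m ℕ.* suc n))      ≈⟨ ι-pos (suc m ℕ.* suc n) ⟩
    (suc m ℕ.* suc n) · 1#                ≈⟨ ×1-homo-* (suc m) (suc n) ⟩
    suc m · 1# * suc n · 1#               ≈⟨ -‿involutive _ ⟨
    - - (suc m · 1# * suc n · 1#)         ≈⟨ -‿cong (-‿distribˡ-* _ _) ⟩
    - (- (suc m · 1#) * suc n · 1#)       ≈⟨ -‿distribʳ-* _ _ ⟩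
    - (suc m · 1#) * - (suc n · 1#)       ∎

  homomorphism : ℤ.+-*-rawRing -Raw-AlmostCommutative⟶ fromCommutativeRing R
  homomorphism = record
    { ⟦_⟧    = ι
    ; +-homo = ι-+
    ; *-homo = ι-*
    ; -‿homo = ι-neg
    ; 0-homo = refl
    ; 1-homo = refl
    }

  _ι≟_ : ∀ i j → Maybe (ι i ≈ ι j)
  i ι≟ j = map (λ i≡j → reflexive (≡.cong ι i≡j)) (dec⇒maybe (i ℤₚ.≟ j))

  open RingSolver ℤ.+-*-rawRing (fromCommutativeRing R) homomorphism _ι≟_ public
    using (Polynomial; solve; _:=_; _:+_; _:*_; _:-_; :-_; con)

  0ₚ 1ₚ : ∀ {n} → Polynomial n
  0ₚ = con (+ 0)
  1ₚ = con (+ 1)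

-- Ordered field arithmetic and the Archimedean property.

module OrderedField (em : ExcludedMiddle 0ℓ) (ℝ : CompleteOrderedField) where
  open CompleteOrderedField ℝ
  open CommutativeRing commutativeRing public
    using (refl; sym; trans; +-cong; +-congˡ; +-congʳ; *-cong; *-congˡ; *-congʳ; -‿cong;
           +-identityˡ; +-identityʳ; +-assoc; *-identityˡ; *-assoc; *-comm; distribˡ; zeroˡ; zeroʳ; -‿inverseʳ)
  open IntegerCoefficients commutativeRing public
    using (Polynomial; solve; _:=_; _:+_; _:*_; _:-_; :-_; 0ₚ; 1ₚ)
  open IsTotalOrder isTotalOrder public
    using (total; antisym; ≤-respˡ-≈; ≤-respʳ-≈)
    renaming (refl to ≤-refl; trans to ≤-trans; reflexive to ≤-reflexive)
  private
    module Strict = ToStrict _≈_ _≤_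

  by-contradiction : ∀ {P : Set} → ¬ ¬ P → P
  by-contradiction = decidable-stable em

  infix 4 _≤?_

  _≤?_ : ∀ x y → x ≤ y ⊎ y < x
  x ≤? y with em {P = x ≤ y} | total x y
  ... | yes x≤y | _        = inj₁ x≤y
  ... | no  x≰y | inj₁ x≤y = ⊥-elim (x≰y x≤y)
  ... | no  x≰y | inj₂ y≤x = inj₂ (y≤x , λ y≈x → x≰y (≤-reflexive (sym y≈x)))

  <⇒≤ : ∀ {x y} → x < y → x ≤ y
  <⇒≤ = proj₁

  <⇒≱ : ∀ {x y} → x < y → ¬ y ≤ x
  <⇒≱ = Strict.<⇒≱ antisym

  ≮⇒≥ : ∀ {x y} → ¬ x < y → y ≤ x
  ≮⇒≥ {x} {y} x≮y with y ≤? x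
  ... | inj₁ y≤x = y≤x
  ... | inj₂ x<y = ⊥-elim (x≮y x<y)

  <-≤-trans : ∀ {x y z} → x < y → y ≤ z → x < z
  <-≤-trans = Strict.<-≤-trans sym ≤-trans antisym ≤-respʳ-≈

  ≤-<-trans : ∀ {x y z} → x ≤ y → y < z → x < z
  ≤-<-trans = Strict.≤-<-trans ≤-trans antisym ≤-respˡ-≈

  gap : ∀ {x y} → x ≤ y → 0# ≤ y - x
  gap {x} {y} x≤y = ≤-respˡ-≈ (solve 1 (λ x → :- x :+ x := 0ₚ) refl x)
    (≤-respʳ-≈ (solve 2 (λ x y → :- x :+ y := y :- x) refl x y) (+-monoʳ-≤ (- x) x≤y))

  -- The format of most inequality proofs below: `e` is a sum of products of nonnegative quantities,
  -- and the ring solver identifies it with y - x.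
  ≤-from : ∀ {x y e} → 0# ≤ e → e ≈ y - x → x ≤ y
  ≤-from {x} {y} {e} 0≤e e≈y-x = ≤-respˡ-≈ (+-identityʳ x)
    (≤-respʳ-≈ (trans (+-congˡ e≈y-x) (solve 2 (λ x y → x :+ (y :- x) := y) refl x y)) (+-monoʳ-≤ x 0≤e))

  gap< : ∀ {x y} → x < y → 0# < y - x
  gap< {x} {y} (x≤y , x≉y) = gap x≤y , λ 0≈y-x → x≉y
    (trans (trans (sym (+-identityʳ x)) (+-congˡ 0≈y-x)) (solve 2 (λ x y → x :+ (y :- x) := y) refl x y))

  <-from : ∀ {x y e} → 0# < e → e ≈ y - x → x < y
  <-from {x} {y} (0≤e , 0≉e) e≈y-x = ≤-from 0≤e e≈y-x , λ x≈y → 0≉e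
    (sym (trans e≈y-x (trans (+-congˡ (-‿cong x≈y)) (-‿inverseʳ y))))

  infixl 6 _⊞_ _⊞<_ _<⊞_
  infixl 7 _⊠_ _⊠<_

  _⊞_ : ∀ {x y} → 0# ≤ x → 0# ≤ y → 0# ≤ x + y
  _⊞_ {x} 0≤x 0≤y = ≤-trans 0≤x (≤-respˡ-≈ (+-identityʳ x) (+-monoʳ-≤ x 0≤y))

  _<⊞_ : ∀ {x y} → 0# < x → 0# ≤ y → 0# < x + y
  _<⊞_ {x} 0<x 0≤y = <-≤-trans 0<x (≤-respˡ-≈ (+-identityʳ x) (+-monoʳ-≤ x 0≤y))

  _⊞<_ : ∀ {x y} → 0# ≤ x → 0# < y → 0# < x + y
  _⊞<_ {x} {y} 0≤x 0<y = <-from (0<y <⊞ 0≤x) (solve 2 (λ x y → y :+ x := x :+ y :- 0ₚ) refl x y)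

  _⊠_ : ∀ {x y} → 0# ≤ x → 0# ≤ y → 0# ≤ x * y
  _⊠_ = *-nonNegative

  *-nonzero : ∀ {x y} → ¬ 0# ≈ x → ¬ 0# ≈ y → ¬ 0# ≈ x * y
  *-nonzero {x} {y} 0≉x 0≉y 0≈xy = 0≉y (sym (trans
    (trans (trans (sym (*-identityˡ y)) (*-congʳ (sym (*-inverseʳ x (λ x≈0 → 0≉x (sym x≈0))))))
      (trans (solve 3 (λ x u y → x :* u :* y := u :* (x :* y)) refl x (x ⁻¹) y) (*-congˡ (sym 0≈xy))))
    (zeroʳ (x ⁻¹))))

  _⊠<_ : ∀ {x y} → 0# < x → 0# < y → 0# < x * y
  _⊠<_ (0≤x , 0≉x) (0≤y , 0≉y) = (0≤x ⊠ 0≤y) , *-nonzero 0≉x 0≉y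

  square-nonneg : ∀ x → 0# ≤ x * x
  square-nonneg x with total 0# x
  ... | inj₁ 0≤x = 0≤x ⊠ 0≤x
  ... | inj₂ x≤0 = ≤-respʳ-≈ (solve 1 (λ x → (0ₚ :- x) :* (0ₚ :- x) := x :* x) refl x)
                     (gap x≤0 ⊠ gap x≤0)

  0<1 : 0# < 1#
  0<1 = ≤-respʳ-≈ (*-identityˡ 1#) (square-nonneg 1#) , λ 0≈1 → 1≉0 (sym 0≈1)

  0≤1 : 0# ≤ 1#
  0≤1 = <⇒≤ 0<1

  -- The inverse is nonnegative because it equals x times its own square.
  reciprocal : ∀ {x} → 0# < x → ∃[ y ] 0# < y × x * y ≈ 1#
  reciprocal {x} (0≤x , 0≉x) = x ⁻¹ ,
    (≤-respʳ-≈ (trans (solve 2 (λ x y → x :* (y :* y) := x :* y :* y) refl x (x ⁻¹))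
                (trans (*-congʳ xx⁻¹≈1) (*-identityˡ _))) (0≤x ⊠ square-nonneg (x ⁻¹))
    , λ 0≈x⁻¹ → 1≉0 (trans (sym xx⁻¹≈1) (trans (*-congˡ (sym 0≈x⁻¹)) (zeroʳ x))))
    , xx⁻¹≈1
    where
    xx⁻¹≈1 : x * x ⁻¹ ≈ 1#
    xx⁻¹≈1 = *-inverseʳ x (λ x≈0 → 0≉x (sym x≈0))

  half : ∀ {x} → 0# < x → ∃[ y ] 0# < y × y + y ≈ x
  half {x} 0<x with reciprocal (0<1 <⊞ 0≤1)
  ... | h , 0<h , 2h≈1 = h * x , 0<h ⊠< 0<x ,
    trans (solve 2 (λ h x → h :* x :+ h :* x := (1ₚ :+ 1ₚ) :* h :* x) refl h x)
      (trans (*-congʳ 2h≈1) (*-identityˡ x))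

  lower-bound : ∀ {x y} → 0# < x → 0# < y → ∃[ z ] 0# < z × z ≤ x × z ≤ y
  lower-bound {x} {y} 0<x 0<y with total x y
  ... | inj₁ x≤y = x , 0<x , ≤-refl , x≤y
  ... | inj₂ y≤x = y , 0<y , y≤x , ≤-refl

  below-supremum : ∀ {S s d} → (∀ b → b ∈ UpperBound S → s ≤ b) → 0# < d →
                   ∃[ x ] x ∈ S × s - d < x
  below-supremum {S} {s} {d} least 0<d with em {P = ∃[ x ] x ∈ S × s - d < x}
  ... | yes p = p
  ... | no ¬p = ⊥-elim (<⇒≱ (<-from 0<d (solve 2 (λ s d → d := s :- (s :- d)) refl s d))
                         (least (s - d) (λ {x} x∈S → ≮⇒≥ λ s-d<x → ¬p (x , x∈S , s-d<x))))

  -- The Archimedean property, stated without natural numbers.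
  doubling-induction : (P : Pred Carrier 0ℓ) → (∀ {x} → 1# ≤ x → x ∈ P) →
    (∀ {x} → 0# < x → x + x ∈ P → x ∈ P) → ∀ {x} → 0# < x → x ∈ P
  doubling-induction P large step {x₀} 0<x₀ with em {P = x₀ ∈ P}
  ... | yes x₀∈P = x₀∈P
  ... | no  x₀∉P with supremum (λ x → 0# < x × x ∉ P) (x₀ , 0<x₀ , x₀∉P) (1# , bounded)
    where
    bounded : 1# ∈ UpperBound (λ x → 0# < x × x ∉ P)
    bounded (_ , x∉P) = ≮⇒≥ λ 1<x → x∉P (large (<⇒≤ 1<x))
  ... | s , upper , least = ⊥-elim (<⇒≱ s-x₀<s (least (s - x₀) smaller))
    where
    s-x₀<s : s - x₀ < s
    s-x₀<s = <-from 0<x₀ (solve 2 (λ s x → x := s :- (s :- x)) refl s x₀)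
    doubled : ∀ {x} → 0# < x → x ∉ P → x + x ≤ s
    doubled 0<x x∉P = upper ((0<x <⊞ <⇒≤ 0<x) , λ 2x∈P → x∉P (step 0<x 2x∈P))
    -- Counterexamples are closed under doubling, so each x stays x₀ below s: if x ≤ x₀ then x ≤ 2x₀
    -- - x₀ ≤ s - x₀, and otherwise x = 2x - x ≤ s - x₀.
    smaller : s - x₀ ∈ UpperBound (λ x → 0# < x × x ∉ P)
    smaller {x} (0<x , x∉P) with total x x₀
    ... | inj₁ x≤x₀ = ≤-from (gap (doubled 0<x₀ x₀∉P) ⊞ gap x≤x₀)
      (solve 3 (λ s x y → (s :- (y :+ y)) :+ (y :- x) := s :- y :- x) refl s x x₀)
    ... | inj₂ x₀≤x = ≤-from (gap (doubled 0<x x∉P) ⊞ gap x₀≤x)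
      (solve 3 (λ s x y → (s :- (x :+ x)) :+ (x :- y) := s :- y :- x) refl s x x₀)

-- Formulas as functions on the cube, and theories of closed sets.

module Semantics (em : ExcludedMiddle 0ℓ) (ℝ : CompleteOrderedField) where
  open CompleteOrderedField ℝ
  open Books ℝ
  open Deduction
  open OrderedField em ℝ
  open MinOp (Minimum.minOperator totalOrder) using (x⊓y≤x; x⊓y≤y; ⊓-glb)

  module _ {k : ℕ} where

    ⟦⟧-bounds : ∀ (φ : Formula k) x → 0# ≤ ⟦ φ ⟧ x × ⟦ φ ⟧ x ≤ 1#
    ⟦⟧-bounds (var i) x = Cube.0≤ x i , Cube.≤1 x i
    ⟦⟧-bounds (~ φ)   x with ⟦⟧-bounds φ x
    ... | 0≤φ , φ≤1 = gap φ≤1 ,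
      ≤-from 0≤φ (solve 1 (λ a → a := 1ₚ :- (1ₚ :- a)) refl _)
    ⟦⟧-bounds (φ ⇒ ψ) x with ⟦⟧-bounds φ x | ⟦⟧-bounds ψ x
    ... | _ , φ≤1 | 0≤ψ , _ = ⊓-glb 0≤1 (gap φ≤1 ⊞ 0≤ψ) , x⊓y≤x _ _

    ⊕-≤ : ∀ (φ ψ : Formula k) x → ⟦ φ ⊕ ψ ⟧ x ≤ ⟦ φ ⟧ x + ⟦ ψ ⟧ x
    ⊕-≤ φ ψ x = ≤-trans (x⊓y≤y _ _)
      (≤-reflexive (solve 2 (λ a b → 1ₚ :- (1ₚ :- a) :+ b := a :+ b) refl (⟦ φ ⟧ x) (⟦ ψ ⟧ x)))

    ⊕-≥ : ∀ (φ ψ : Formula k) x {c} → c ≤ 1# → c ≤ ⟦ φ ⟧ x + ⟦ ψ ⟧ x → c ≤ ⟦ φ ⊕ ψ ⟧ x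
    ⊕-≥ φ ψ x c≤1 c≤φ+ψ = ⊓-glb c≤1 (≤-trans c≤φ+ψ
      (≤-reflexive (solve 2 (λ a b → a :+ b := 1ₚ :- (1ₚ :- a) :+ b) refl (⟦ φ ⟧ x) (⟦ ψ ⟧ x))))

    ⊙-≥ : ∀ (φ ψ : Formula k) x → ⟦ φ ⟧ x + ⟦ ψ ⟧ x - 1# ≤ ⟦ φ ⊙ ψ ⟧ x
    ⊙-≥ φ ψ x = ≤-from (gap (⊕-≤ (~ φ) (~ ψ) x))
      (solve 3 (λ a b c → ((1ₚ :- a) :+ (1ₚ :- b)) :- c := (1ₚ :- c) :- (a :+ b :- 1ₚ)) refl
        (⟦ φ ⟧ x) (⟦ ψ ⟧ x) (⟦ ~ φ ⊕ ~ ψ ⟧ x))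

    ⊙-≤ : ∀ (φ ψ : Formula k) x {c} → 0# ≤ c → ⟦ φ ⟧ x + ⟦ ψ ⟧ x - 1# ≤ c → ⟦ φ ⊙ ψ ⟧ x ≤ c
    ⊙-≤ φ ψ x {c} 0≤c φ+ψ-1≤c = ≤-from (gap (⊕-≥ (~ φ) (~ ψ) x
        (≤-from 0≤c (solve 1 (λ c → c := 1ₚ :- (1ₚ :- c)) refl c))
        (≤-from (gap φ+ψ-1≤c) (solve 3 (λ a b c →
          c :- (a :+ b :- 1ₚ) := ((1ₚ :- a) :+ (1ₚ :- b)) :- (1ₚ :- c)) refl (⟦ φ ⟧ x) (⟦ ψ ⟧ x) c))))
      (solve 2 (λ c d → d :- (1ₚ :- c) := c :- (1ₚ :- d)) refl c (⟦ ~ φ ⊕ ~ ψ ⟧ x))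

    ⇒-refl-true : ∀ (ψ : Formula k) x → 1# ≤ ⟦ ψ ⇒ ψ ⟧ x
    ⇒-refl-true ψ x = ⊓-glb ≤-refl (≤-reflexive (solve 1 (λ a → 1ₚ := 1ₚ :- a :+ a) refl (⟦ ψ ⟧ x)))

    ~-false : ∀ (φ : Formula k) x → 1# ≤ ⟦ φ ⟧ x → ⟦ ~ φ ⟧ x ≤ 0#
    ~-false φ x 1≤φ = ≤-from (gap 1≤φ) (solve 1 (λ a → a :- 1ₚ := 0ₚ :- (1ₚ :- a)) refl (⟦ φ ⟧ x))

    ~-true : ∀ (φ : Formula k) x → ⟦ φ ⟧ x ≤ 0# → 1# ≤ ⟦ ~ φ ⟧ x
    ~-true φ x φ≤0 = ≤-from (gap φ≤0) (solve 1 (λ a → 0ₚ :- a := (1ₚ :- a) :- 1ₚ) refl (⟦ φ ⟧ x))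

    ⊕-false : ∀ (φ ψ : Formula k) x → ⟦ φ ⟧ x ≤ 0# → ⟦ ψ ⟧ x ≤ 0# → ⟦ φ ⊕ ψ ⟧ x ≤ 0#
    ⊕-false φ ψ x φ≤0 ψ≤0 = ≤-trans (⊕-≤ φ ψ x) (≤-from (gap φ≤0 ⊞ gap ψ≤0)
      (solve 2 (λ a b → (0ₚ :- a) :+ (0ₚ :- b) := 0ₚ :- (a :+ b)) refl (⟦ φ ⟧ x) (⟦ ψ ⟧ x)))

    ⊕-trueˡ : ∀ (φ ψ : Formula k) x → 1# ≤ ⟦ φ ⟧ x → 1# ≤ ⟦ φ ⊕ ψ ⟧ x
    ⊕-trueˡ φ ψ x 1≤φ = ⊕-≥ φ ψ x ≤-refl (≤-from (gap 1≤φ ⊞ proj₁ (⟦⟧-bounds ψ x))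
      (solve 2 (λ a b → (a :- 1ₚ) :+ b := (a :+ b) :- 1ₚ) refl (⟦ φ ⟧ x) (⟦ ψ ⟧ x)))

    ⊕-trueʳ : ∀ (φ ψ : Formula k) x → 1# ≤ ⟦ ψ ⟧ x → 1# ≤ ⟦ φ ⊕ ψ ⟧ x
    ⊕-trueʳ φ ψ x 1≤ψ = ⊕-≥ φ ψ x ≤-refl (≤-from (proj₁ (⟦⟧-bounds φ x) ⊞ gap 1≤ψ)
      (solve 2 (λ a b → a :+ (b :- 1ₚ) := (a :+ b) :- 1ₚ) refl (⟦ φ ⟧ x) (⟦ ψ ⟧ x)))

    ^-true : ∀ (ψ : Formula k) x m → 1# ≤ ⟦ ψ ⟧ x → 1# ≤ ⟦ ψ ^ m ⟧ x
    ^-true ψ x zero            1≤ψ = ⇒-refl-true ψ x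
    ^-true ψ x (suc zero)      1≤ψ = 1≤ψ
    ^-true ψ x (suc m@(suc _)) 1≤ψ = ≤-trans
      (≤-from (gap 1≤ψ ⊞ gap (^-true ψ x m 1≤ψ))
        (solve 2 (λ a b → (a :- 1ₚ) :+ (b :- 1ₚ) := (a :+ b :- 1ₚ) :- 1ₚ) refl (⟦ ψ ⟧ x) (⟦ ψ ^ m ⟧ x)))
      (⊙-≥ ψ (ψ ^ m) x)

    -- Witnessed by a composite of the doubling maps ψ ↦ ψ ⊕ ψ and ψ ↦ ψ ⊙ ψ.
    Step : Carrier → Carrier → Set
    Step s t = Σ (Formula k → Formula k) λ T → ∀ (ψ : Formula k) x →
      (⟦ ψ ⟧ x ≤ s → ⟦ T ψ ⟧ x ≤ 0#) × (t ≤ ⟦ ψ ⟧ x → 1# ≤ ⟦ T ψ ⟧ x)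

    step-id : ∀ {s t} → s ≤ 0# → 1# ≤ t → Step s t
    step-id s≤0 1≤t = (λ ψ → ψ) , λ ψ x → (λ ψ≤s → ≤-trans ψ≤s s≤0) , ≤-trans 1≤t

    step-⊕ : ∀ {s t s′ t′} → s + s ≤ s′ → t′ ≤ 1# → t′ ≤ t + t → Step s′ t′ → Step s t
    step-⊕ 2s≤s′ t′≤1 t′≤2t (T , T-step) = (λ ψ → T (ψ ⊕ ψ)) , λ ψ x →
      (λ ψ≤s → proj₁ (T-step (ψ ⊕ ψ) x) (≤-trans (⊕-≤ ψ ψ x) (≤-trans (double ψ≤s) 2s≤s′))) ,
      (λ t≤ψ → proj₂ (T-step (ψ ⊕ ψ) x) (⊕-≥ ψ ψ x t′≤1 (≤-trans t′≤2t (double t≤ψ))))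
      where
      double : ∀ {x y} → x ≤ y → x + x ≤ y + y
      double {x} {y} x≤y = ≤-from (gap x≤y ⊞ gap x≤y)
        (solve 2 (λ x y → (y :- x) :+ (y :- x) := (y :+ y) :- (x :+ x)) refl x y)

    step-⊙ : ∀ {s t s′ t′} → 0# ≤ s′ → s + s - 1# ≤ s′ → t′ ≤ t + t - 1# → Step s′ t′ → Step s t
    step-⊙ 0≤s′ 2s-1≤s′ t′≤2t-1 (T , T-step) = (λ ψ → T (ψ ⊙ ψ)) , λ ψ x →
      (λ ψ≤s → proj₁ (T-step (ψ ⊙ ψ) x) (⊙-≤ ψ ψ x 0≤s′ (≤-trans (double ψ≤s) 2s-1≤s′))) ,
      (λ t≤ψ → proj₂ (T-step (ψ ⊙ ψ) x) (≤-trans (≤-trans t′≤2t-1 (double t≤ψ)) (⊙-≥ ψ ψ x)))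
      where
      double : ∀ {x y} → x ≤ y → x + x - 1# ≤ y + y - 1#
      double {x} {y} x≤y = ≤-from (gap x≤y ⊞ gap x≤y)
        (solve 2 (λ x y → (y :- x) :+ (y :- x) := (y :+ y :- 1ₚ) :- (x :+ x :- 1ₚ)) refl x y)

    -- Squaring fixes 1 and doubles the distance from s to 1, until s is at most 1/2 and one more
    -- squaring sends it to 0.
    step-to-1 : ∀ {δ} → 0# < δ → ∀ s → δ ≤ 1# - s → Step s 1#
    step-to-1 = doubling-induction (λ δ → ∀ s → δ ≤ 1# - s → Step s 1#)
      (λ 1≤δ s δ≤1-s → step-id
        (≤-from (gap 1≤δ ⊞ gap δ≤1-s)
          (solve 2 (λ δ s → (δ :- 1ₚ) :+ (1ₚ :- s :- δ) := 0ₚ :- s) refl _ s))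
        ≤-refl)
      ind-step
      where
      1≤1+1-1 : 1# ≤ 1# + 1# - 1#
      1≤1+1-1 = ≤-reflexive (solve 0 (1ₚ := 1ₚ :+ 1ₚ :- 1ₚ) refl)
      ind-step : ∀ {δ} → 0# < δ → (∀ s → δ + δ ≤ 1# - s → Step s 1#) → ∀ s → δ ≤ 1# - s → Step s 1#
      ind-step {δ} _ IH s δ≤1-s with total (s + s) 1#
      ... | inj₁ 2s≤1 = step-⊙ ≤-refl
        (≤-from (gap 2s≤1) (solve 1 (λ s → 1ₚ :- (s :+ s) := 0ₚ :- (s :+ s :- 1ₚ)) refl s))
        1≤1+1-1 (step-id ≤-refl ≤-refl)
      ... | inj₂ 1≤2s = step-⊙ (gap 1≤2s) ≤-refl 1≤1+1-1
        (IH (s + s - 1#) (≤-from (gap δ≤1-s ⊞ gap δ≤1-s)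
          (solve 2 (λ s δ → (1ₚ :- s :- δ) :+ (1ₚ :- s :- δ) := (1ₚ :- (s :+ s :- 1ₚ)) :- (δ :+ δ)) refl s δ)))

    -- While s and t lie on the same side of 1/2, one of the maps doubles t - s: ⊕ below 1/2, ⊙
    -- above. Once 1/2 separates them, ⊕ sends t to 1 and `step-to-1` finishes.
    step-within-unit : ∀ {δ} → 0# < δ → ∀ s t → 0# ≤ s → t ≤ 1# → δ ≤ t - s → Step s t
    step-within-unit = doubling-induction (λ δ → ∀ s t → 0# ≤ s → t ≤ 1# → δ ≤ t - s → Step s t)
      (λ 1≤δ s t 0≤s t≤1 δ≤t-s → step-id
        (≤-from (gap 1≤δ ⊞ gap δ≤t-s ⊞ gap t≤1)
          (solve 3 (λ δ s t → (δ :- 1ₚ) :+ (t :- s :- δ) :+ (1ₚ :- t) := 0ₚ :- s) refl _ s t))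
        (≤-from (gap 1≤δ ⊞ gap δ≤t-s ⊞ 0≤s)
          (solve 3 (λ δ s t → (δ :- 1ₚ) :+ (t :- s :- δ) :+ s := t :- 1ₚ) refl _ s t)))
      ind-step
      where
      ind-step : ∀ {δ} → 0# < δ → (∀ s t → 0# ≤ s → t ≤ 1# → δ + δ ≤ t - s → Step s t) →
                  ∀ s t → 0# ≤ s → t ≤ 1# → δ ≤ t - s → Step s t
      ind-step {δ} _ IH s t 0≤s t≤1 δ≤t-s with total (t + t) 1# | 1# ≤? (s + s)
      ... | inj₁ 2t≤1 | _ = step-⊕ ≤-refl 2t≤1 ≤-refl
        (IH (s + s) (t + t) (0≤s ⊞ 0≤s) 2t≤1 (≤-from (gap δ≤t-s ⊞ gap δ≤t-s)
          (solve 3 (λ s t δ → (t :- s :- δ) :+ (t :- s :- δ) := ((t :+ t) :- (s :+ s)) :- (δ :+ δ)) refl s t δ)))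
      ... | inj₂ _ | inj₁ 1≤2s = step-⊙ (gap 1≤2s) ≤-refl ≤-refl
        (IH (s + s - 1#) (t + t - 1#) (gap 1≤2s)
          (≤-from (gap t≤1 ⊞ gap t≤1)
            (solve 1 (λ t → (1ₚ :- t) :+ (1ₚ :- t) := 1ₚ :- (t :+ t :- 1ₚ)) refl t))
          (≤-from (gap δ≤t-s ⊞ gap δ≤t-s)
            (solve 3 (λ s t δ → (t :- s :- δ) :+ (t :- s :- δ) :=
              ((t :+ t :- 1ₚ) :- (s :+ s :- 1ₚ)) :- (δ :+ δ)) refl s t δ)))
      ... | inj₂ 1≤2t | inj₂ 2s<1 =
        step-⊕ ≤-refl ≤-refl 1≤2t (step-to-1 (gap< 2s<1) (s + s) ≤-refl)

    -- A coordinate of β shifted by ε may leave the unit interval. Then one of the two conditions is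
    -- vacuous and a constant formula serves.
    step : ∀ {s t} → s < t → Step s t
    step {s} {t} s<t with 0# ≤? s | t ≤? 1#
    ... | inj₁ 0≤s | inj₁ t≤1 = step-within-unit (gap< s<t) s t 0≤s t≤1 ≤-refl
    ... | inj₂ s<0 | _ = (λ ψ → ψ ⇒ ψ) , λ ψ x →
      (λ ψ≤s → ⊥-elim (<⇒≱ s<0 (≤-trans (proj₁ (⟦⟧-bounds ψ x)) ψ≤s))) , (λ _ → ⇒-refl-true ψ x)
    ... | inj₁ _ | inj₂ 1<t = (λ ψ → ~ (ψ ⇒ ψ)) , λ ψ x →
      (λ _ → ~-false (ψ ⇒ ψ) x (⇒-refl-true ψ x)) ,
      (λ t≤ψ → ⊥-elim (<⇒≱ 1<t (≤-trans t≤ψ (proj₂ (⟦⟧-bounds ψ x)))))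

    -- The language has no constants, so the empty sum is built from a given formula θ.
    ⨁ : Formula k → ∀ {l} → (Fin l → Formula k) → Formula k
    ⨁ θ {zero}  F = ~ (θ ⇒ θ)
    ⨁ θ {suc l} F = F zero ⊕ ⨁ θ (F ∘ suc)

    ⨁-false : ∀ θ {l} (F : Fin l → Formula k) x → (∀ i → ⟦ F i ⟧ x ≤ 0#) → ⟦ ⨁ θ F ⟧ x ≤ 0#
    ⨁-false θ {zero}  F x F≤0 = ~-false (θ ⇒ θ) x (⇒-refl-true θ x)
    ⨁-false θ {suc l} F x F≤0 =
      ⊕-false (F zero) (⨁ θ (F ∘ suc)) x (F≤0 zero) (⨁-false θ (F ∘ suc) x (F≤0 ∘ suc))

    ⨁-true : ∀ θ {l} (F : Fin l → Formula k) x i → 1# ≤ ⟦ F i ⟧ x → 1# ≤ ⟦ ⨁ θ F ⟧ x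
    ⨁-true θ F x zero    1≤Fi = ⊕-trueˡ (F zero) (⨁ θ (F ∘ suc)) x 1≤Fi
    ⨁-true θ F x (suc i) 1≤Fi = ⊕-trueʳ (F zero) (⨁ θ (F ∘ suc)) x (⨁-true θ (F ∘ suc) x i 1≤Fi)

    near-or-far : ∀ {ε} (y z : Point k) → Near ε y z ⊎ ∃[ i ] (y i + ε ≤ z i ⊎ z i ≤ y i - ε)
    near-or-far {ε} y z with em {P = ∃[ i ] (y i + ε ≤ z i ⊎ z i ≤ y i - ε)}
    ... | yes far = inj₂ far
    ... | no ¬far = inj₁ λ i → near-coordinate i (z i ≤? (y i - ε)) ((y i + ε) ≤? z i)
      where
      near-coordinate : ∀ i → z i ≤ y i - ε ⊎ y i - ε < z i → y i + ε ≤ z i ⊎ z i < y i + ε →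
                        Within ε (y i) (z i)
      near-coordinate i (inj₁ z≤y-ε) _ = ⊥-elim (¬far (i , inj₂ z≤y-ε))
      near-coordinate i _ (inj₁ y+ε≤z) = ⊥-elim (¬far (i , inj₁ y+ε≤z))
      near-coordinate i (inj₂ y-ε<z) (inj₂ z<y+ε) =
        <-from (gap< y-ε<z) (solve 3 (λ y z ε → z :- (y :- ε) := ε :- (y :- z)) refl (y i) (z i) ε) ,
        <-from (gap< z<y+ε) (solve 3 (λ y z ε → y :+ ε :- z := ε :- (z :- y)) refl (y i) (z i) ε)

    away-from-closure : ∀ {P : Pred (Point k) 0ℓ} {y} → y ∉ closure P →
                        ∃[ ε ] 0# < ε × (∀ z → z ∈ P → ¬ Near ε y z)
    away-from-closure {P} {y} y∉P with em {P = ∃[ ε ] 0# < ε × (∀ z → z ∈ P → ¬ Near ε y z)}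
    ... | yes p = p
    ... | no ¬p = ⊥-elim (y∉P approximate)
      where
      approximate : y ∈ closure P
      approximate ε 0<ε with em {P = ∃[ z ] z ∈ P × Near ε y z}
      ... | yes q = q
      ... | no ¬q = ⊥-elim (¬p (ε , 0<ε , λ z z∈P near → ¬q (z , z∈P , near)))

    -- A point of P misses the ε-box around β, so some coordinate is at least ε above or at least ε
    -- below that of β. `F⁺` detects the former and the negation of `F⁻` the latter, while both are
    -- 0 at β.
    separating-formula : Formula k → ∀ {P} (β : Cube k) → pt β ∉ closure P →
                         ∃[ ψ ] ψ ∈ Th P × ⟦ ψ ⟧ β ≤ 0#
    separating-formula θ {P} β β∉P with away-from-closure {P} β∉P
    ... | ε , 0<ε , far = ⨁ θ F , F-true , ⨁-false θ F β F-false
      where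
      up : ∀ i → Step (pt β i) (pt β i + ε)
      up i = step (<-from 0<ε (solve 2 (λ y ε → ε := y :+ ε :- y) refl (pt β i) ε))
      down : ∀ i → Step (pt β i - ε) (pt β i)
      down i = step (<-from 0<ε (solve 2 (λ y ε → ε := y :- (y :- ε)) refl (pt β i) ε))
      F⁺ F⁻ F : Fin k → Formula k
      F⁺ i = proj₁ (up i) (var i)
      F⁻ i = proj₁ (down i) (var i)
      F i = F⁺ i ⊕ ~ F⁻ i
      F-false : ∀ i → ⟦ F i ⟧ β ≤ 0#
      F-false i = ⊕-false (F⁺ i) (~ F⁻ i) β (proj₁ (proj₂ (up i) (var i) β) ≤-refl)
        (~-false (F⁻ i) β (proj₂ (proj₂ (down i) (var i) β) ≤-refl))
      F-true : ⨁ θ F ∈ Th P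
      F-true x x∈P = antisym (proj₂ (⟦⟧-bounds (⨁ θ F) x)) (true-at (near-or-far (pt β) (pt x)))
        where
        true-at : Near ε (pt β) (pt x) ⊎ ∃[ i ] (pt β i + ε ≤ pt x i ⊎ pt x i ≤ pt β i - ε) → 1# ≤ ⟦ ⨁ θ F ⟧ x
        true-at (inj₁ near)            = ⊥-elim (far (pt x) x∈P near)
        true-at (inj₂ (i , inj₁ above)) = ⨁-true θ F x i
          (⊕-trueˡ (F⁺ i) (~ F⁻ i) x (proj₂ (proj₂ (up i) (var i) x) above))
        true-at (inj₂ (i , inj₂ below)) = ⨁-true θ F x i
          (⊕-trueʳ (F⁺ i) (~ F⁻ i) x (~-true (F⁻ i) x (proj₁ (proj₂ (down i) (var i) x) below)))

    Th-antitone⁻¹ : Formula k → ∀ {P} → closure P ⊆ P → (β : Cube k) →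
                    (∀ ψ → ψ ∈ Th P → ψ ∈ Th (singleton (pt β))) → pt β ∈ P
    Th-antitone⁻¹ θ {P} closed β Th⊆ = by-contradiction λ β∉P →
      refute (separating-formula θ {P} β (λ β∈P̄ → β∉P (closed β∈P̄)))
      where
      refute : ¬ (∃[ ψ ] ψ ∈ Th P × ⟦ ψ ⟧ β ≤ 0#)
      refute (ψ , ψ∈Th , ψ≤0) = <⇒≱ 0<1 (≤-respˡ-≈ (Th⊆ ψ ψ∈Th β (λ i → refl)) ψ≤0)

    -- Soundness of the calculus is available through `Axiomatizes`, which says that the theory of β
    -- is deductively closed. It thus contains π, and by minimality all of `Th P`.
    implication⇒∈ : ∀ {P} → closure P ⊆ P → (β : Cube k) → ∀ {π θ : Formula k} →
      Axiomatizes π (Th P) → Axiomatizes θ (Th (singleton (pt β))) →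
      (∃[ m ] (NonZero m × (⊢ θ ^ m ⇒ π))) → pt β ∈ P
    implication⇒∈ closed β {π} {θ} (_ , _ , least) (theory , θ∈Th , _) (m , _ , ⊢π) =
      -- The formula π itself is the one from which truth constants are built.
      Th-antitone⁻¹ π closed β λ ψ → least (Th (singleton (pt β))) theory π∈Th {ψ}
      where
      weaken : ∀ {φ} → ⊢ φ → Th (singleton (pt β)) ⊩ φ
      weaken (ax a)   = ax a
      weaken (mp p q) = mp (weaken p) (weaken q)
      θ^m∈Th : θ ^ m ∈ Th (singleton (pt β))
      θ^m∈Th x x≈β = antisym (proj₂ (⟦⟧-bounds (θ ^ m) x))
        (^-true θ x m (≤-reflexive (sym (θ∈Th x x≈β))))
      π∈Th : π ∈ Th (singleton (pt β))
      π∈Th = theory {π} (mp (hyp {φ = θ ^ m} θ^m∈Th) (weaken ⊢π))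

    ∈⇒implication : ∀ {P} → closure P ⊆ P → (β : Cube k) → ∀ {π θ : Formula k} →
      Axiomatizes π (Th P) → Axiomatizes θ (Th (singleton (pt β))) →
      pt β ∈ P → ∃[ m ] (NonZero m × (⊢ θ ^ m ⇒ π))
    ∈⇒implication {P} closed β {π} (_ , π∈Th , _) θ-axiom β∈P = local-deduction
      -- Closedness carries membership from β over to every point equal to it up to `≈ₚ`.
      (axiomatizes⇒⊩ θ-axiom {π} λ x x≈β → π∈Th x (closed λ ε 0<ε → pt β , β∈P , λ i →
        vanishing 0<ε (x≈β i) , vanishing 0<ε (sym (x≈β i))))
      where
      vanishing : ∀ {ε a b} → 0# < ε → a ≈ b → a - b < ε
      vanishing 0<ε a≈b = ≤-<-trans (≤-reflexive (trans (+-congʳ a≈b) (-‿inverseʳ _))) 0<ε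

-- Convex cones and their supporting functionals.

module ConvexCones (em : ExcludedMiddle 0ℓ) (ℝ : CompleteOrderedField) where
  open CompleteOrderedField ℝ
  open Books ℝ
  open OrderedField em ℝ

  infixl 6 _⊹_
  infixr 7 _⊛_
  infix  8 ⊝_
  infix  7 _∙_

  _⊹_ : ∀ {k} → Point k → Point k → Point k
  (x ⊹ y) i = x i + y i

  _⊛_ : ∀ {k} → Carrier → Point k → Point k
  (t ⊛ y) i = t * y i

  ⊝_ : ∀ {k} → Point k → Point k
  (⊝ y) i = - y i

  𝟎 : ∀ {k} → Point k
  𝟎 i = 0#

  _∙_ : ∀ {k} → Point k → Point k → Carrier
  σ ∙ y = sum λ i → σ i * y i

  ∙-congˡ : ∀ {k} (σ : Point k) {x y} → x ≈ₚ y → σ ∙ x ≈ σ ∙ y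
  ∙-congˡ {zero}  σ x≈y = refl
  ∙-congˡ {suc k} σ x≈y = +-cong (*-congˡ (x≈y zero)) (∙-congˡ (tail σ) (x≈y ∘ suc))

  ∙-⊹ : ∀ {k} (σ x y : Point k) → σ ∙ (x ⊹ y) ≈ σ ∙ x + σ ∙ y
  ∙-⊹ {zero}  σ x y = solve 0 (0ₚ := 0ₚ :+ 0ₚ) refl
  ∙-⊹ {suc k} σ x y = trans (+-congˡ (∙-⊹ (tail σ) (tail x) (tail y)))
    (solve 5 (λ s a b p q → s :* (a :+ b) :+ (p :+ q) := s :* a :+ p :+ (s :* b :+ q)) refl
      (σ zero) (x zero) (y zero) (tail σ ∙ tail x) (tail σ ∙ tail y))

  ∙-⊛ : ∀ {k} (σ : Point k) t x → σ ∙ (t ⊛ x) ≈ t * (σ ∙ x)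
  ∙-⊛ {zero}  σ t x = sym (zeroʳ t)
  ∙-⊛ {suc k} σ t x = trans (+-congˡ (∙-⊛ (tail σ) t (tail x)))
    (solve 4 (λ s t a p → s :* (t :* a) :+ t :* p := t :* (s :* a :+ p)) refl
      (σ zero) t (x zero) (tail σ ∙ tail x))

  ⊝-∙ : ∀ {k} (σ x : Point k) → ⊝ σ ∙ x ≈ - (σ ∙ x)
  ⊝-∙ {zero}  σ x = solve 0 (0ₚ := :- 0ₚ) refl
  ⊝-∙ {suc k} σ x = trans (+-congˡ (⊝-∙ (tail σ) (tail x)))
    (solve 3 (λ s a p → :- s :* a :+ :- p := :- (s :* a :+ p)) refl (σ zero) (x zero) (tail σ ∙ tail x))

  ∙-⊝ : ∀ {k} (σ x : Point k) → σ ∙ ⊝ x ≈ - (σ ∙ x)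
  ∙-⊝ {zero}  σ x = solve 0 (0ₚ := :- 0ₚ) refl
  ∙-⊝ {suc k} σ x = trans (+-congˡ (∙-⊝ (tail σ) (tail x)))
    (solve 3 (λ s a p → s :* :- a :+ :- p := :- (s :* a :+ p)) refl (σ zero) (x zero) (tail σ ∙ tail x))

  𝟎-∙ : ∀ {k} (x : Point k) → 𝟎 ∙ x ≈ 0#
  𝟎-∙ {zero}  x = refl
  𝟎-∙ {suc k} x = trans (+-cong (zeroˡ (x zero)) (𝟎-∙ (tail x))) (+-identityʳ 0#)

  ∙-𝟎 : ∀ {k} (σ : Point k) → σ ∙ 𝟎 ≈ 0#
  ∙-𝟎 {zero}  σ = refl
  ∙-𝟎 {suc k} σ = trans (+-cong (zeroʳ (σ zero)) (∙-𝟎 (tail σ))) (+-identityʳ 0#)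

  Bounded : ∀ {k} → Carrier → Pred (Point k) 0ℓ
  Bounded r y = ∀ i → y i ≤ r × - r ≤ y i

  bounded-mono : ∀ {k r s} {y : Point k} → r ≤ s → Bounded r y → Bounded s y
  bounded-mono {r = r} {s} r≤s y≤r i =
    ≤-trans (proj₁ (y≤r i)) r≤s ,
    ≤-trans (≤-from (gap r≤s) (solve 2 (λ r s → s :- r := :- r :- :- s) refl r s)) (proj₂ (y≤r i))

  bounded-⊝ : ∀ {k r} {y : Point k} → Bounded r y → Bounded r (⊝ y)
  bounded-⊝ {r = r} {y} y≤r i =
    ≤-from (gap (proj₂ (y≤r i))) (solve 2 (λ y r → y :- :- r := r :- :- y) refl (y i) r) ,
    ≤-from (gap (proj₁ (y≤r i))) (solve 2 (λ y r → r :- y := :- y :- :- r) refl (y i) r)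

  bounded-resp : ∀ {k r s} {x y : Point k} → r ≈ s → x ≈ₚ y → Bounded r x → Bounded s y
  bounded-resp r≈s x≈y x≤r i =
    ≤-respʳ-≈ r≈s (≤-respˡ-≈ (x≈y i) (proj₁ (x≤r i))) ,
    ≤-respʳ-≈ (x≈y i) (≤-respˡ-≈ (-‿cong r≈s) (proj₂ (x≤r i)))

  bounded-⊹ : ∀ {k r s} {x y : Point k} → Bounded r x → Bounded s y → Bounded (r + s) (x ⊹ y)
  bounded-⊹ {r = r} {s} {x} {y} x≤r y≤s i =
    ≤-from (gap (proj₁ (x≤r i)) ⊞ gap (proj₁ (y≤s i)))
      (solve 4 (λ r s x y → (r :- x) :+ (s :- y) := (r :+ s) :- (x :+ y)) refl r s (x i) (y i)) ,
    ≤-from (gap (proj₂ (x≤r i)) ⊞ gap (proj₂ (y≤s i)))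
      (solve 4 (λ r s x y → (x :- :- r) :+ (y :- :- s) := (x :+ y) :- :- (r :+ s)) refl r s (x i) (y i))

  bounded-⊛ : ∀ {k r t} {y : Point k} → 0# ≤ t → Bounded r y → Bounded (t * r) (t ⊛ y)
  bounded-⊛ {r = r} {t} {y} 0≤t y≤r i =
    ≤-from (0≤t ⊠ gap (proj₁ (y≤r i)))
      (solve 3 (λ t r y → t :* (r :- y) := t :* r :- t :* y) refl t r (y i)) ,
    ≤-from (0≤t ⊠ gap (proj₂ (y≤r i)))
      (solve 3 (λ t r y → t :* (y :- :- r) := t :* y :- :- (t :* r)) refl t r (y i))

  norm : ∀ {k} (y : Point k) → ∃[ U ] 0# ≤ U × Bounded U y
  norm {zero}  y = 0# , ≤-refl , λ ()
  norm {suc k} y with norm (tail y) | total 0# (y zero)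
  ... | U , 0≤U , y≤U | inj₁ 0≤y₀ = U + y zero , 0≤U ⊞ 0≤y₀ , λ where
    zero    → ≤-from 0≤U (solve 2 (λ U y → U := U :+ y :- y) refl U (y zero)) ,
              ≤-from (0≤U ⊞ 0≤y₀ ⊞ 0≤y₀) (solve 2 (λ U y → U :+ y :+ y := y :- :- (U :+ y)) refl U (y zero))
    (suc i) → bounded-mono (≤-from 0≤y₀ (solve 2 (λ U y → y := U :+ y :- U) refl U (y zero))) y≤U i
  ... | U , 0≤U , y≤U | inj₂ y₀≤0 = U - y zero ,
    ≤-from (0≤U ⊞ gap y₀≤0) (solve 2 (λ U y → U :+ (0ₚ :- y) := U :- y :- 0ₚ) refl U (y zero)) , λ where
    zero    → ≤-from (0≤U ⊞ gap y₀≤0 ⊞ gap y₀≤0)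
                (solve 2 (λ U y → U :+ (0ₚ :- y) :+ (0ₚ :- y) := U :- y :- y) refl U (y zero)) ,
              ≤-from 0≤U (solve 2 (λ U y → U := y :- :- (U :- y)) refl U (y zero))
    (suc i) → bounded-mono (≤-from (gap y₀≤0) (solve 2 (λ U y → 0ₚ :- y := U :- y :- U) refl U (y zero))) y≤U i

  -- M is the sum of the absolute values of σ, the norm dual to the maximum norm.
  ∙-bound : ∀ {k} (σ : Point k) → ∃[ M ] 0# ≤ M × (∀ {r v} → 0# ≤ r → Bounded r v → σ ∙ v ≤ M * r)
  ∙-bound {zero}  σ = 0# , ≤-refl , λ {r} _ _ → ≤-reflexive (sym (zeroˡ r))
  ∙-bound {suc k} σ with ∙-bound (tail σ) | total 0# (σ zero)
  ... | M , 0≤M , bound | inj₁ 0≤σ₀ = σ zero + M , 0≤σ₀ ⊞ 0≤M , λ {r} {v} 0≤r v≤r →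
    ≤-from (0≤σ₀ ⊠ gap (proj₁ (v≤r zero)) ⊞ gap (bound 0≤r (v≤r ∘ suc)))
      (solve 5 (λ s v r M p → s :* (r :- v) :+ (M :* r :- p) := (s :+ M) :* r :- (s :* v :+ p)) refl
        (σ zero) (v zero) r M (tail σ ∙ tail v))
  ... | M , 0≤M , bound | inj₂ σ₀≤0 = 0# - σ zero + M , gap σ₀≤0 ⊞ 0≤M , λ {r} {v} 0≤r v≤r →
    ≤-from (gap σ₀≤0 ⊠ gap (proj₂ (v≤r zero)) ⊞ gap (bound 0≤r (v≤r ∘ suc)))
      (solve 5 (λ s v r M p → (0ₚ :- s) :* (v :- :- r) :+ (M :* r :- p) :=
        (0ₚ :- s :+ M) :* r :- (s :* v :+ p)) refl (σ zero) (v zero) r M (tail σ ∙ tail v))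

  -- C c y says that y lies in a convex cone by a representation of total weight c.
  record WeightedCone {k} (C : Carrier → Pred (Point k) 0ℓ) : Set where
    field
      resp   : ∀ {c x y} → x ≈ₚ y → C c x → C c y
      origin : C 0# 𝟎
      add    : ∀ {c d x y} → C c x → C d y → C (c + d) (x ⊹ y)
      scale  : ∀ {t c y} → 0# ≤ t → C c y → C (t * c) (t ⊛ y)
      weight : ∀ {c y} → C c y → 0# ≤ c

  Symmetric Supported : ∀ {k} → (Carrier → Pred (Point k) 0ℓ) → Set
  Symmetric C = ∀ {c y} → C c y → ∃[ d ] C d (⊝ y)
  Supported C = ∃[ σ ] (∀ {c y} → C c y → 0# ≤ σ ∙ y) × ∃[ c ] ∃[ y ] C c y × 0# < σ ∙ y

  slice : ∀ {k} → (Carrier → Pred (Point (suc k)) 0ℓ) → Carrier → Pred (Point k) 0ℓ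
  slice C c y = C c (0# ∷ y)

  module _ {k} {C : Carrier → Pred (Point (suc k)) 0ℓ} (cone : WeightedCone C) where
    open WeightedCone cone

    slice-cone : WeightedCone (slice C)
    slice-cone = record
      { resp   = λ x≈y → resp λ { zero → refl ; (suc i) → x≈y i }
      ; origin = resp (λ { zero → refl ; (suc i) → refl }) origin
      ; add    = λ Cx Cy → resp (λ { zero → +-identityʳ 0# ; (suc i) → refl }) (add Cx Cy)
      ; scale  = λ {t} 0≤t Cy → resp (λ { zero → zeroʳ t ; (suc i) → refl }) (scale 0≤t Cy)
      ; weight = weight
      }

    to-slice : ∀ {c y} → y zero ≈ 0# → C c y → slice C c (tail y)
    to-slice y₀≈0 = resp λ { zero → y₀≈0 ; (suc i) → refl }

    normalize : ∀ {c y} → 0# < y zero → C c y → ∃[ d ] ∃[ u ] C d u × u zero ≈ 1#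
    normalize {c} {y} 0<y₀ Cy with reciprocal 0<y₀
    ... | r , 0<r , y₀r≈1 = r * c , r ⊛ y , scale (<⇒≤ 0<r) Cy , trans (*-comm r (y zero)) y₀r≈1

    -- The vector y + t w lies in the slice, hence so does its opposite; adding t w back leaves - y.
    reflect : Symmetric (slice C) → ∀ {c d y w t} → 0# ≤ t → C c y → C d w → y zero + t * w zero ≈ 0# →
              ∃[ e ] C e (⊝ y)
    reflect symmetric {y = y} {w} {t} 0≤t Cy Cw vanishes
      with symmetric (to-slice vanishes (add Cy (scale 0≤t Cw)))
    ... | e , C-tail = _ , resp pointwise (add C-tail (scale 0≤t Cw))
      where
      pointwise : (0# ∷ ⊝ tail (y ⊹ t ⊛ w)) ⊹ t ⊛ w ≈ₚ ⊝ y
      pointwise zero    = trans (solve 2 (λ y p → 0ₚ :+ p := y :+ p :- y) refl (y zero) (t * w zero))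
        (trans (+-congʳ vanishes) (+-identityˡ _))
      pointwise (suc i) = solve 2 (λ y p → :- (y :+ p) :+ p := :- y) refl (y (suc i)) (t * w (suc i))

    -- The Hahn–Banach step: s is the slope of the extended functional along the new axis, squeezed
    -- between the values dictated by the vectors of first coordinate 1 and those of first coordinate −1.
    extend : ∀ {c d u w} → C c u → u zero ≈ 1# → C d w → w zero ≈ - 1# → Supported (slice C) → Supported C
    extend {u = u} {w} Cu u₀≈1 Cw w₀≈-1 (τ , τ≥0 , c , h , Ch , 0<τ∙h) =
      s ∷ τ , nonneg , c , 0# ∷ h , Ch , <-≤-trans 0<τ∙h
        (≤-reflexive (solve 2 (λ s p → p := s :* 0ₚ :+ p) refl s (τ ∙ h)))
      where
      -- The sum y + z lies in the slice, where τ is nonnegative.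
      below : ∀ {c d y z} → C c y → y zero ≈ 1# → C d z → z zero ≈ - 1# → - (τ ∙ tail y) ≤ τ ∙ tail z
      below {y = y} {z} Cy y₀≈1 Cz z₀≈-1 = ≤-from
        (τ≥0 (to-slice (trans (+-cong y₀≈1 z₀≈-1) (-‿inverseʳ 1#)) (add Cy Cz)))
        (trans (∙-⊹ τ (tail y) (tail z))
          (solve 2 (λ p q → p :+ q := q :- :- p) refl (τ ∙ tail y) (τ ∙ tail z)))
      S : Pred Carrier 0ℓ
      S r = ∃[ c ] ∃[ y ] C c y × y zero ≈ 1# × r ≈ - (τ ∙ tail y)
      sup : ∃[ s ] s ∈ UpperBound S × (∀ b → b ∈ UpperBound S → s ≤ b)
      sup = supremum S (_ , _ , _ , Cu , u₀≈1 , refl)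
        (τ ∙ tail w , λ { (_ , _ , Cy , y₀≈1 , r≈) → ≤-respˡ-≈ (sym r≈) (below Cy y₀≈1 Cw w₀≈-1) })
      s : Carrier
      s = proj₁ sup
      nonneg : ∀ {c y} → C c y → 0# ≤ (s ∷ τ) ∙ y
      nonneg {y = y} Cy with 0# ≤? y zero | y zero ≤? 0#
      ... | inj₁ 0≤y₀ | inj₁ y₀≤0 = ≤-trans (τ≥0 (to-slice y₀≈0 Cy)) (≤-reflexive
        (trans (solve 2 (λ s p → p := s :* 0ₚ :+ p) refl s (τ ∙ tail y)) (+-congʳ (*-congˡ (sym y₀≈0)))))
        where
        y₀≈0 : y zero ≈ 0#
        y₀≈0 = antisym y₀≤0 0≤y₀
      ... | _ | inj₂ 0<y₀ with reciprocal 0<y₀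
      ...   | r , 0<r , y₀r≈1 = ≤-respʳ-≈ equation
        (<⇒≤ 0<y₀ ⊠ gap (proj₁ (proj₂ sup)
          (_ , r ⊛ y , scale (<⇒≤ 0<r) Cy , trans (*-comm r (y zero)) y₀r≈1 , refl)))
        where
        equation : y zero * (s - - (τ ∙ tail (r ⊛ y))) ≈ (s ∷ τ) ∙ y
        equation = trans (*-congˡ (+-congˡ (-‿cong (-‿cong (∙-⊛ τ r (tail y))))))
          (trans (solve 4 (λ y s r p → y :* (s :- :- (r :* p)) := s :* y :+ (y :* r) :* p) refl
                   (y zero) s r (τ ∙ tail y))
            (+-congˡ (trans (*-congʳ y₀r≈1) (*-identityˡ _))))
      nonneg {y = y} Cy | inj₂ y₀<0 | _ with reciprocal (gap< y₀<0)
      ...   | r , 0<r , -y₀r≈1 = ≤-respʳ-≈ equation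
        (gap (<⇒≤ y₀<0) ⊠ gap (proj₂ (proj₂ sup) (τ ∙ tail (r ⊛ y)) λ { (_ , _ , Cz , z₀≈1 , p≈) →
          ≤-respˡ-≈ (sym p≈) (below Cz z₀≈1 (scale (<⇒≤ 0<r) Cy) ry₀≈-1) }))
        where
        ry₀≈-1 : r * y zero ≈ - 1#
        ry₀≈-1 = trans (solve 2 (λ r y → r :* y := :- ((0ₚ :- y) :* r)) refl r (y zero)) (-‿cong -y₀r≈1)
        equation : (0# - y zero) * (τ ∙ tail (r ⊛ y) - s) ≈ (s ∷ τ) ∙ y
        equation = trans (*-congˡ (+-congʳ (∙-⊛ τ r (tail y))))
          (trans (solve 4 (λ y s r p → (0ₚ :- y) :* (r :* p :- s) := s :* y :+ ((0ₚ :- y) :* r) :* p) refl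
                   (y zero) s r (τ ∙ tail y))
            (+-congˡ (trans (*-congʳ -y₀r≈1) (*-identityˡ _))))

    flat-symmetric : (∀ {c y} → C c y → y zero ≈ 0#) → Symmetric (slice C) → Symmetric C
    flat-symmetric flat symmetric {y = y} Cy with symmetric (to-slice (flat Cy) Cy)
    ... | d , C-y = d , resp (λ { zero → 0≈-y₀ ; (suc i) → refl }) C-y
      where
      0≈-y₀ : 0# ≈ - y zero
      0≈-y₀ = trans (solve 0 (0ₚ := :- 0ₚ) refl) (-‿cong (sym (flat Cy)))

    flat-supported : (∀ {c y} → C c y → y zero ≈ 0#) → Supported (slice C) → Supported C
    flat-supported flat (τ , τ≥0 , c , h , Ch , 0<τ∙h) =
      0# ∷ τ , (λ {c} {y} Cy → ≤-trans (τ≥0 (to-slice (flat Cy) Cy)) (≤-reflexive (sym (drop y)))) ,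
      c , 0# ∷ h , Ch , <-≤-trans 0<τ∙h (≤-reflexive (sym (drop (0# ∷ h))))
      where
      drop : ∀ y → (0# ∷ τ) ∙ y ≈ τ ∙ tail y
      drop y = solve 2 (λ y p → 0ₚ :* y :+ p := p) refl (y zero) (τ ∙ tail y)

    first-coordinate-supported : ∀ a → (∀ {c y} → C c y → 0# ≤ a * y zero) →
      ∃[ c ] ∃[ y ] C c y × 0# < a * y zero → Supported C
    first-coordinate-supported a a≥0 (c , y , Cy , 0<ay₀) =
      a ∷ 𝟎 , (λ {_} {y} Cy → ≤-trans (a≥0 Cy) (≤-reflexive (sym (drop y)))) ,
      c , y , Cy , <-≤-trans 0<ay₀ (≤-reflexive (sym (drop y)))
      where
      drop : ∀ y → (a ∷ 𝟎) ∙ y ≈ a * y zero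
      drop y = trans (+-congˡ (𝟎-∙ (tail y))) (+-identityʳ _)

  -- If the first coordinate takes only one strict sign on C, it or its negative is a support
  -- functional; if it vanishes on C, the slice decides. If both signs occur, a support functional
  -- of the slice extends, and symmetry of the slice spreads to C by reflection along vectors with
  -- first coordinate 1 and -1.
  supported-or-symmetric : ∀ {k} {C : Carrier → Pred (Point k) 0ℓ} →
    WeightedCone C → Symmetric C ⊎ Supported C
  supported-or-symmetric {zero} cone = inj₁ λ {c} Cy → c , WeightedCone.resp cone (λ ()) Cy
  supported-or-symmetric {suc k} {C} cone =
    cases em em (supported-or-symmetric (slice-cone cone))
    where
    open WeightedCone cone
    Positive Negative : Set
    Positive = ∃[ c ] ∃[ y ] C c y × 0# < y zero
    Negative = ∃[ c ] ∃[ y ] C c y × y zero < 0#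
    nonpos : ¬ Positive → ∀ {c y} → C c y → y zero ≤ 0#
    nonpos ¬pos Cy = ≮⇒≥ λ 0<y₀ → ¬pos (_ , _ , Cy , 0<y₀)
    nonneg : ¬ Negative → ∀ {c y} → C c y → 0# ≤ y zero
    nonneg ¬neg Cy = ≮⇒≥ λ y₀<0 → ¬neg (_ , _ , Cy , y₀<0)
    normalize⁻ : ∀ {c y} → y zero < 0# → C c y → ∃[ d ] ∃[ w ] C d w × w zero ≈ - 1#
    normalize⁻ {c} {y} y₀<0 Cy with reciprocal (gap< y₀<0)
    ... | r , 0<r , -y₀r≈1 = r * c , r ⊛ y , scale (<⇒≤ 0<r) Cy ,
      trans (solve 2 (λ r y → r :* y := :- ((0ₚ :- y) :* r)) refl r (y zero)) (-‿cong -y₀r≈1)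
    cases : Dec Positive → Dec Negative → Symmetric (slice C) ⊎ Supported (slice C) →
            Symmetric C ⊎ Supported C
    cases (no ¬pos) (no ¬neg) (inj₁ symmetric) = inj₁ (flat-symmetric cone
      (λ Cy → antisym (nonpos ¬pos Cy) (nonneg ¬neg Cy)) symmetric)
    cases (no ¬pos) (no ¬neg) (inj₂ supported) = inj₂ (flat-supported cone
      (λ Cy → antisym (nonpos ¬pos Cy) (nonneg ¬neg Cy)) supported)
    cases (yes (c , y , Cy , 0<y₀)) (no ¬neg) _ = inj₂ (first-coordinate-supported cone 1#
      (λ {_} {y} Cy → ≤-respʳ-≈ (sym (*-identityˡ (y zero))) (nonneg ¬neg Cy))
      (c , y , Cy , <-≤-trans 0<y₀ (≤-reflexive (sym (*-identityˡ (y zero))))))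
    cases (no ¬pos) (yes (c , y , Cy , y₀<0)) _ = inj₂ (first-coordinate-supported cone (- 1#)
      (λ {_} {y} Cy → ≤-respʳ-≈ (negation y) (gap (nonpos ¬pos Cy)))
      (c , y , Cy , <-≤-trans (gap< y₀<0) (≤-reflexive (negation y))))
      where
      negation : ∀ y → 0# - y zero ≈ - 1# * y zero
      negation y = solve 1 (λ y → 0ₚ :- y := :- 1ₚ :* y) refl (y zero)
    cases (yes (c , y , Cy , 0<y₀)) (yes (d , z , Cz , z₀<0)) slice-case
      with normalize cone 0<y₀ Cy | normalize⁻ z₀<0 Cz
    ... | _ , u , Cu , u₀≈1 | _ , w , Cw , w₀≈-1 = both slice-case
      where
      both : Symmetric (slice C) ⊎ Supported (slice C) → Symmetric C ⊎ Supported C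
      both (inj₂ supported) = inj₂ (extend cone Cu u₀≈1 Cw w₀≈-1 supported)
      both (inj₁ symmetric) = inj₁ λ {_} {y} Cy → opposite y Cy (total 0# (y zero))
        where
        opposite : ∀ y {c} → C c y → 0# ≤ y zero ⊎ y zero ≤ 0# → ∃[ d ] C d (⊝ y)
        opposite y Cy (inj₁ 0≤y₀) = reflect cone symmetric 0≤y₀ Cy Cw
          (trans (+-congˡ (*-congˡ w₀≈-1)) (solve 1 (λ y → y :+ y :* :- 1ₚ := 0ₚ) refl (y zero)))
        opposite y Cy (inj₂ y₀≤0) = reflect cone symmetric (gap y₀≤0) Cy Cu
          (trans (+-congˡ (*-congˡ u₀≈1)) (solve 1 (λ y → y :+ (0ₚ :- y) :* 1ₚ := 0ₚ) refl (y zero)))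

-- Economical representations, generated cones and their thickenings.

module GeneratedCones (em : ExcludedMiddle 0ℓ) (ℝ : CompleteOrderedField) where
  open CompleteOrderedField ℝ
  open Books ℝ
  open OrderedField em ℝ
  open ConvexCones em ℝ

  -- The given weight c may be arbitrarily wasteful for the vector y; a second representation is
  -- sought whose weight is controlled by the size of y.
  WeightBound : ∀ {k} → (Carrier → Pred (Point k) 0ℓ) → Carrier → Set
  WeightBound C M = ∀ {c y r} → C c y → Bounded r y → ∃[ d ] C d y × d ≤ M * r

  module _ {k} {C : Carrier → Pred (Point (suc k)) 0ℓ} (cone : WeightedCone C) where
    open WeightedCone cone

    flat-weight-bound : (∀ {c y} → C c y → y zero ≈ 0#) → ∀ {M} → WeightBound (slice C) M → WeightBound C M
    flat-weight-bound flat bound Cy y≤r with bound (to-slice cone (flat Cy) Cy) (y≤r ∘ suc)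
    ... | d , C-tail , d≤Mr = d , resp (λ { zero → sym (flat Cy) ; (suc i) → refl }) C-tail , d≤Mr

    -- Subtracting t p moves y into the slice and, as t ≤ r, leaves a vector of size at most r (1 +
    -- U). Adding t p back costs weight t a ≤ r a.
    slope-weight-bound : ∀ {M a b p U} → C a p → C b (⊝ p) → 0# ≤ U → Bounded U (tail p) →
      WeightBound (slice C) M →
      ∀ {c y r t} → C c y → Bounded r y → 0# ≤ t → t ≤ r → y zero ≈ t * p zero →
      ∃[ d ] C d y × d ≤ (M * (1# + U) + a) * r
    slope-weight-bound {M} {a} {b} {p} {U} Cp C-p 0≤U p≤U bound {c} {y} {r} {t} Cy y≤r 0≤t t≤r y₀≈tp₀ =
      combine (bound (to-slice cone vanishes (add Cy (scale 0≤t C-p))) bounded)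
      where
      vanishes : y zero + t * - p zero ≈ 0#
      vanishes = trans (+-congʳ y₀≈tp₀) (solve 2 (λ t p → t :* p :+ t :* :- p := 0ₚ) refl t (p zero))
      bounded : Bounded (r * (1# + U)) (tail (y ⊹ t ⊛ ⊝ p))
      bounded i =
        ≤-from (gap (proj₁ (y≤r (suc i))) ⊞ 0≤t ⊠ gap (proj₂ (p≤U i)) ⊞ gap t≤r ⊠ 0≤U)
          (solve 5 (λ y r t U p → (r :- y) :+ t :* (p :- :- U) :+ (r :- t) :* U :=
            r :* (1ₚ :+ U) :- (y :+ t :* :- p)) refl (y (suc i)) r t U (p (suc i))) ,
        ≤-from (gap (proj₂ (y≤r (suc i))) ⊞ 0≤t ⊠ gap (proj₁ (p≤U i)) ⊞ gap t≤r ⊠ 0≤U)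
          (solve 5 (λ y r t U p → (y :- :- r) :+ t :* (U :- p) :+ (r :- t) :* U :=
            (y :+ t :* :- p) :- :- (r :* (1ₚ :+ U))) refl (y (suc i)) r t U (p (suc i)))
      combine : ∃[ d ] C d (0# ∷ tail (y ⊹ t ⊛ ⊝ p)) × d ≤ M * (r * (1# + U)) →
                ∃[ d ] C d y × d ≤ (M * (1# + U) + a) * r
      combine (d , C-tail , d≤) = d + t * a , resp pointwise (add C-tail (scale 0≤t Cp)) ,
        ≤-from (gap d≤ ⊞ gap t≤r ⊠ weight Cp)
          (solve 6 (λ M r U d t a → M :* (r :* (1ₚ :+ U)) :- d :+ (r :- t) :* a :=
            (M :* (1ₚ :+ U) :+ a) :* r :- (d :+ t :* a)) refl M r U d t a)
        where
        pointwise : (0# ∷ tail (y ⊹ t ⊛ ⊝ p)) ⊹ t ⊛ p ≈ₚ y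
        pointwise zero    = trans (+-identityˡ _) (sym y₀≈tp₀)
        pointwise (suc i) = solve 3 (λ y t p → y :+ t :* :- p :+ t :* p := y) refl (y (suc i)) t (p (suc i))

  -- By homogeneity this says that a cone which is a linear space contains a neighbourhood of the
  -- origin in that space all of whose points have weight at most 1.
  weight-bound : ∀ {k} {C : Carrier → Pred (Point k) 0ℓ} → WeightedCone C → Symmetric C →
    ∃[ M ] 0# ≤ M × WeightBound C M
  weight-bound {zero}      cone symmetric = 0# , ≤-refl , λ {_} {_} {r} _ _ →
    0# , WeightedCone.resp cone (λ ()) (WeightedCone.origin cone) , ≤-reflexive (sym (zeroˡ r))
  weight-bound {suc k} {C} cone symmetric =
    cases em (weight-bound (slice-cone cone) slice-symmetric)
    where
    open WeightedCone cone
    slice-symmetric : Symmetric (slice C)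
    slice-symmetric Cy with symmetric Cy
    ... | d , C-y = d , resp (λ { zero → solve 0 (:- 0ₚ := 0ₚ) refl ; (suc i) → refl }) C-y
    Positive : Set
    Positive = ∃[ c ] ∃[ y ] C c y × 0# < y zero
    nonpos : ¬ Positive → ∀ {c y} → C c y → y zero ≤ 0#
    nonpos ¬pos Cy = ≮⇒≥ λ 0<y₀ → ¬pos (_ , _ , Cy , 0<y₀)
    flat : ¬ Positive → ∀ {c y} → C c y → y zero ≈ 0#
    flat ¬pos {y = y} Cy = antisym (nonpos ¬pos Cy)
      (≤-from (gap (nonpos ¬pos (proj₂ (symmetric Cy)))) (solve 1 (λ y → 0ₚ :- :- y := y :- 0ₚ) refl (y zero)))
    cases : Dec Positive → ∃[ M ] 0# ≤ M × WeightBound (slice C) M → ∃[ M ] 0# ≤ M × WeightBound C M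
    cases (no ¬pos) (M , 0≤M , bound) = M , 0≤M , flat-weight-bound cone (flat ¬pos) bound
    cases (yes (_ , _ , Cv , 0<v₀)) (M , 0≤M , bound) = sloped (normalize cone 0<v₀ Cv)
      where
      sloped : ∃[ a ] ∃[ u ] C a u × u zero ≈ 1# → ∃[ M ] 0# ≤ M × WeightBound C M
      sloped (a , u , Cu , u₀≈1) = both (symmetric Cu) (norm (tail u))
        where
        both : ∃[ b ] C b (⊝ u) → ∃[ U ] 0# ≤ U × Bounded U (tail u) → ∃[ M ] 0# ≤ M × WeightBound C M
        -- Vectors with y₀ ≥ 0 are reduced along u, which costs a; those with y₀ ≤ 0 along - u,
        -- which costs b. The sum covers both cases.
        both (b , C-u) (U , 0≤U , u≤U) = N + a + b , 0≤N ⊞ weight Cu ⊞ weight C-u ,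
          λ {_} {y} Cy y≤r → bounded y Cy y≤r (total 0# (y zero))
          where
          N : Carrier
          N = M * (1# + U)
          0≤N : 0# ≤ N
          0≤N = 0≤M ⊠ (0≤1 ⊞ 0≤U)
          bounded : ∀ y {c r} → C c y → Bounded r y → 0# ≤ y zero ⊎ y zero ≤ 0# →
                    ∃[ d ] C d y × d ≤ (N + a + b) * r
          bounded y {c} {r} Cy y≤r (inj₁ 0≤y₀) = increase
            (slope-weight-bound cone Cu C-u 0≤U u≤U bound Cy y≤r 0≤y₀ (proj₁ (y≤r zero))
              (sym (trans (*-congˡ u₀≈1) (trans (*-comm _ _) (*-identityˡ _)))))
            where
            increase : ∃[ d ] C d y × d ≤ (N + a) * r → ∃[ d ] C d y × d ≤ (N + a + b) * r
            increase (d , Cy′ , d≤) = d , Cy′ , ≤-from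
              (gap d≤ ⊞ weight C-u ⊠ ≤-trans 0≤y₀ (proj₁ (y≤r zero)))
              (solve 5 (λ N a b r d → ((N :+ a) :* r :- d) :+ b :* r := (N :+ a :+ b) :* r :- d) refl N a b r d)
          bounded y {c} {r} Cy y≤r (inj₂ y₀≤0) = increase
            (slope-weight-bound cone C-u (resp (λ i → solve 1 (λ u → u := :- :- u) refl (u i)) Cu)
              0≤U (bounded-⊝ u≤U) bound Cy y≤r (gap y₀≤0) -y₀≤r
              (trans (solve 1 (λ y → y := (0ₚ :- y) :* :- 1ₚ) refl (y zero)) (*-congˡ (-‿cong (sym u₀≈1)))))
            where
            -y₀≤r : 0# - y zero ≤ r
            -y₀≤r = ≤-from (gap (proj₂ (y≤r zero)))
              (solve 2 (λ y r → y :- :- r := r :- (0ₚ :- y)) refl (y zero) r)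
            increase : ∃[ d ] C d y × d ≤ (N + b) * r → ∃[ d ] C d y × d ≤ (N + a + b) * r
            increase (d , Cy′ , d≤) = d , Cy′ , ≤-from
              (gap d≤ ⊞ weight Cu ⊠ ≤-trans (gap y₀≤0) -y₀≤r)
              (solve 5 (λ N a b r d → ((N :+ b) :* r :- d) :+ a :* r := (N :+ a :+ b) :* r :- d) refl N a b r d)

  module _ {k} {X : Set} (b : X → Point k) where

    -- The equalities are stored in the constructors because weights and vectors matter only up to
    -- setoid equality, while indices would unify up to `≡`.
    data Cone : Carrier → Pred (Point k) 0ℓ where
      nil  : ∀ {c y} → c ≈ 0# → y ≈ₚ 𝟎 → Cone c y
      cons : ∀ {t c c′ y y′} x → 0# ≤ t → Cone c y → c′ ≈ t + c → y′ ≈ₚ t ⊛ b x ⊹ y → Cone c′ y′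

  module _ {k} {X : Set} {b : X → Point k} where

    cone-resp : ∀ {c c′ y y′} → c ≈ c′ → y ≈ₚ y′ → Cone b c y → Cone b c′ y′
    cone-resp c≈c′ y≈y′ (nil c≈0 y≈0) = nil (trans (sym c≈c′) c≈0) (λ i → trans (sym (y≈y′ i)) (y≈0 i))
    cone-resp c≈c′ y≈y′ (cons x 0≤t C c≈ y≈) =
      cons x 0≤t C (trans (sym c≈c′) c≈) (λ i → trans (sym (y≈y′ i)) (y≈ i))

    cone-add : ∀ {c d y z} → Cone b c y → Cone b d z → Cone b (c + d) (y ⊹ z)
    cone-add (nil c≈0 y≈0) D = cone-resp (sym (trans (+-congʳ c≈0) (+-identityˡ _)))
      (λ i → sym (trans (+-congʳ (y≈0 i)) (+-identityˡ _))) D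
    cone-add (cons x 0≤t C c≈ y≈) D = cons x 0≤t (cone-add C D)
      (trans (+-congʳ c≈) (+-assoc _ _ _)) (λ i → trans (+-congʳ (y≈ i)) (+-assoc _ _ _))

    cone-scale : ∀ {t c y} → 0# ≤ t → Cone b c y → Cone b (t * c) (t ⊛ y)
    cone-scale {t} 0≤t (nil c≈0 y≈0) =
      nil (trans (*-congˡ c≈0) (zeroʳ t)) (λ i → trans (*-congˡ (y≈0 i)) (zeroʳ t))
    cone-scale {t} 0≤t (cons x 0≤s C c≈ y≈) = cons x (0≤t ⊠ 0≤s) (cone-scale 0≤t C)
      (trans (*-congˡ c≈) (distribˡ _ _ _))
      (λ i → trans (*-congˡ (y≈ i)) (trans (distribˡ _ _ _) (+-congʳ (sym (*-assoc _ _ _)))))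

    cone-weight : ∀ {c y} → Cone b c y → 0# ≤ c
    cone-weight (nil c≈0 _)          = ≤-reflexive (sym c≈0)
    cone-weight (cons _ 0≤t C c≈ _) = ≤-respʳ-≈ (sym c≈) (0≤t ⊞ cone-weight C)

    generated : WeightedCone (Cone b)
    generated = record
      { resp   = cone-resp refl
      ; origin = nil refl (λ i → refl)
      ; add    = cone-add
      ; scale  = cone-scale
      ; weight = cone-weight
      }

    generator : ∀ x → Cone b 1# (b x)
    generator x = cons x 0≤1 (nil refl (λ i → refl)) (sym (+-identityʳ 1#))
      (λ i → sym (trans (+-identityʳ _) (*-identityˡ _)))

    cone-≤ : ∀ (σ : Point k) {a} → (∀ x → σ ∙ b x ≤ a) → ∀ {c y} → Cone b c y → σ ∙ y ≤ a * c
    cone-≤ σ {a} σ≤a {c} (nil c≈0 y≈0) = ≤-reflexive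
      (trans (∙-congˡ σ y≈0) (trans (∙-𝟎 σ) (sym (trans (*-congˡ c≈0) (zeroʳ a)))))
    cone-≤ σ {a} σ≤a {c} (cons {t} {d} {y = y} x 0≤t C c≈ y≈) =
      ≤-respˡ-≈ (sym (trans (∙-congˡ σ y≈) (trans (∙-⊹ σ (t ⊛ b x) y) (+-congʳ (∙-⊛ σ t (b x))))))
        (≤-respʳ-≈ (*-congˡ (sym c≈))
          (≤-from (0≤t ⊠ gap (σ≤a x) ⊞ gap (cone-≤ σ σ≤a C))
            (solve 5 (λ a t d p q → t :* (a :- p) :+ (a :* d :- q) := a :* (t :+ d) :- (t :* p :+ q)) refl
              a t d (σ ∙ b x) (σ ∙ y))))

    -- The cone over the ε-neighbourhood of the generators: its support functionals are bounded away
    -- from 0 on the generators, which turns weak separation into strict separation.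
    Thick : Carrier → Carrier → Pred (Point k) 0ℓ
    Thick ε c y = ∃[ p ] Cone b c p × Bounded (ε * c) (y ⊹ ⊝ p)

    thick : ∀ {ε} → 0# ≤ ε → WeightedCone (Thick ε)
    thick {ε} 0≤ε = record
      { resp   = λ { x≈y (p , C , near) → p , C , bounded-resp refl (λ i → +-congʳ (x≈y i)) near }
      ; origin = 𝟎 , nil refl (λ i → refl) , bounded-resp (sym (zeroʳ ε))
          (λ i → sym (-‿inverseʳ 0#)) (λ i → ≤-refl , ≤-reflexive (solve 0 (:- 0ₚ := 0ₚ) refl))
      ; add    = λ { {c} {d} {x} {y} (p , C , p-near) (q , D , q-near) → p ⊹ q , cone-add C D ,
          bounded-resp (sym (distribˡ ε c d))
            (λ i → solve 4 (λ x y p q → (x :+ :- p) :+ (y :+ :- q) := (x :+ y) :+ :- (p :+ q)) refl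
              (x i) (y i) (p i) (q i))
            (bounded-⊹ p-near q-near) }
      ; scale  = λ { {t} {c} {y} 0≤t (p , C , near) → t ⊛ p , cone-scale 0≤t C ,
          bounded-resp (solve 3 (λ t ε c → t :* (ε :* c) := ε :* (t :* c)) refl t ε c)
            (λ i → solve 3 (λ t y p → t :* (y :+ :- p) := t :* y :+ :- (t :* p)) refl t (y i) (p i))
            (bounded-⊛ 0≤t near) }
      ; weight = λ { (p , C , _) → cone-weight C }
      }

-- Compactness of the cube and uniform bounds.

module Compactness (em : ExcludedMiddle 0ℓ) (ℝ : CompleteOrderedField) where
  open CompleteOrderedField ℝ
  open Books ℝ
  open OrderedField em ℝ
  open ConvexCones em ℝ

  Within-mono : ∀ {δ ε x y} → δ ≤ ε → Within δ x y → Within ε x y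
  Within-mono δ≤ε (x-y<δ , y-x<δ) = <-≤-trans x-y<δ δ≤ε , <-≤-trans y-x<δ δ≤ε

  -- Stands in for open covers: a property that passes to subsets and binary unions and holds near
  -- each point holds on the whole cube, without any finite subcover being named.
  record IsIdeal {A : Set} (P : Pred A 0ℓ → Set) : Set₁ where
    field
      down  : ∀ {S T} → S ⊆ T → P T → P S
      union : ∀ {S T} → P S → P T → P (S ∪ T)

  module _ {Q : Pred Carrier 0ℓ → Set} (ideal : IsIdeal Q)
           (local : ∀ t → 0# ≤ t → t ≤ 1# → ∃[ δ ] 0# < δ × Q (Within δ t)) where
    open IsIdeal ideal

    private
      Reached : Pred Carrier 0ℓ
      Reached s = s ≤ 1# × Q (λ t → 0# ≤ t × t ≤ s)

      0-reached : Reached 0#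
      0-reached with local 0# ≤-refl 0≤1
      ... | δ , 0<δ , Qδ = 0≤1 , down (λ { {t} (0≤t , t≤0) →
        ≤-<-trans (≤-from 0≤t (solve 1 (λ t → t := 0ₚ :- (0ₚ :- t)) refl t)) 0<δ ,
        ≤-<-trans (≤-from (gap t≤0) (solve 1 (λ t → 0ₚ :- t := 0ₚ :- (t :- 0ₚ)) refl t)) 0<δ }) Qδ

      sup : ∃[ s ] s ∈ UpperBound Reached × (∀ b → b ∈ UpperBound Reached → s ≤ b)
      sup = supremum Reached (0# , 0-reached) (1# , proj₁)

      s : Carrier
      s = proj₁ sup

      advance : ∀ {δ x u} → Q (Within δ s) → s - δ < x → Reached x → u < s + δ → Q (λ t → 0# ≤ t × t ≤ u)
      advance {δ} {x} {u} Qδ s-δ<x (_ , Qx) u<s+δ = down covered (union Qx Qδ)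
        where
        covered : (λ t → 0# ≤ t × t ≤ u) ⊆ ((λ t → 0# ≤ t × t ≤ x) ∪ Within δ s)
        covered {t} (0≤t , t≤u) with t ≤? x
        ... | inj₁ t≤x = inj₁ (0≤t , t≤x)
        ... | inj₂ x<t = inj₂
          ( <-from (gap< s-δ<x <⊞ gap (<⇒≤ x<t))
              (solve 4 (λ s δ x t → (x :- (s :- δ)) :+ (t :- x) := δ :- (s :- t)) refl s δ x t)
          , <-from (gap< u<s+δ <⊞ gap t≤u)
              (solve 4 (λ s δ u t → (s :+ δ :- u) :+ (u :- t) := δ :- (t :- s)) refl s δ u t))

    -- Let s be the supremum of the endpoints reached from 0. A reached interval ending beyond s -
    -- δ, joined to the δ-neighbourhood of s, reaches s + δ/2, which contradicts the choice of s
    -- unless 1 has been passed.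
    heine-borel-interval : Q (λ t → 0# ≤ t × t ≤ 1#)
    heine-borel-interval = near-s (local s (proj₁ (proj₂ sup) 0-reached) (proj₂ (proj₂ sup) 1# proj₁))
      where
      near-s : ∃[ δ ] 0# < δ × Q (Within δ s) → Q (λ t → 0# ≤ t × t ≤ 1#)
      near-s (δ , 0<δ , Qδ) = past-s (half 0<δ) (below-supremum (proj₂ (proj₂ sup)) 0<δ)
        where
        past-s : ∃[ h ] 0# < h × h + h ≈ δ → ∃[ x ] x ∈ Reached × s - δ < x → Q (λ t → 0# ≤ t × t ≤ 1#)
        past-s (h , 0<h , 2h≈δ) (x , x-reached , s-δ<x) = choose (total 1# (s + h))
          where
          s+h<s+δ : s + h < s + δ
          s+h<s+δ = <-from 0<h (trans (solve 2 (λ s h → h := s :+ (h :+ h) :- (s :+ h)) refl s h)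
            (+-congʳ (+-congˡ 2h≈δ)))
          choose : 1# ≤ s + h ⊎ s + h ≤ 1# → Q (λ t → 0# ≤ t × t ≤ 1#)
          choose (inj₁ 1≤s+h) = advance Qδ s-δ<x x-reached (≤-<-trans 1≤s+h s+h<s+δ)
          choose (inj₂ s+h≤1) = ⊥-elim (<⇒≱
            (<-from 0<h (solve 2 (λ s h → h := s :+ h :- s) refl s h))
            (proj₁ (proj₂ sup) (s+h≤1 , advance Qδ s-δ<x x-reached s+h<s+δ)))

  Unit : ∀ n → Pred (Point n) 0ℓ
  Unit n y = ∀ i → 0# ≤ y i × y i ≤ 1#

  -- The tube lemma: for a fixed first coordinate t, compactness of the remaining cube gives all
  -- boxes over t a common width, and these tubes are then joined along the interval.
  heine-borel : ∀ {n} {P : Pred (Point n) 0ℓ → Set} → IsIdeal P →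
    (∀ x → x ∈ Unit n → ∃[ δ ] 0# < δ × P (Near δ x)) → P (Unit n)
  heine-borel {zero}      ideal local =
    IsIdeal.down ideal (λ _ ()) (proj₂ (proj₂ (local [] λ ())))
  heine-borel {suc n} {P} ideal local =
    down (λ y∈U → y∈U zero , y∈U ∘ suc) (heine-borel-interval tube-ideal tube)
    where
    open IsIdeal ideal
    tube-ideal : IsIdeal (λ A → P (λ y → A (y zero) × tail y ∈ Unit n))
    tube-ideal = record
      { down  = λ S⊆T → down λ { (y₀∈S , y∈U) → S⊆T y₀∈S , y∈U }
      ; union = λ PS PT → down (λ { (inj₁ y₀∈S , y∈U) → inj₁ (y₀∈S , y∈U)
                                 ; (inj₂ y₀∈T , y∈U) → inj₂ (y₀∈T , y∈U) }) (union PS PT)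
      }
    tube : ∀ t → 0# ≤ t → t ≤ 1# →
           ∃[ δ ] 0# < δ × P (λ y → Within δ t (y zero) × tail y ∈ Unit n)
    tube t 0≤t t≤1 = heine-borel box-ideal box
      where
      Box : Pred (Point n) 0ℓ → Set
      Box B = ∃[ δ ] 0# < δ × P (λ y → Within δ t (y zero) × tail y ∈ B)
      box-ideal : IsIdeal Box
      box-ideal .IsIdeal.down S⊆T (δ , 0<δ , Pδ) =
        δ , 0<δ , down (λ { (near , y∈S) → near , S⊆T y∈S }) Pδ
      box-ideal .IsIdeal.union (δ , 0<δ , Pδ) (ε , 0<ε , Pε) with lower-bound 0<δ 0<ε
      ... | η , 0<η , η≤δ , η≤ε = η , 0<η , down
        (λ { (near , inj₁ y∈S) → inj₁ (Within-mono η≤δ near , y∈S)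
           ; (near , inj₂ y∈T) → inj₂ (Within-mono η≤ε near , y∈T) }) (union Pδ Pε)
      box : ∀ x → x ∈ Unit n → ∃[ δ ] 0# < δ × Box (Near δ x)
      box x x∈U with local (t ∷ x) (λ { zero → 0≤t , t≤1 ; (suc i) → x∈U i })
      ... | δ , 0<δ , Pδ = δ , 0<δ , δ , 0<δ ,
        down (λ { (near , nears) zero → near ; (near , nears) (suc i) → nears i }) Pδ

  -- Sets on which g is uniformly negative form an ideal, and near each y continuity keeps g below
  -- half of its value at y.
  negative-continuous : ∀ {n} {g : Cube n → Carrier} → Continuous g → (∀ x → g x < 0#) →
    ∃[ ε ] 0# < ε × (∀ x → g x ≤ - ε)
  negative-continuous {n} {g} continuous g<0 = on-cube (heine-borel ideal local)
    where
    P : Pred (Point n) 0ℓ → Set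
    P S = ∃[ ε ] 0# < ε × (∀ x → pt x ∈ S → g x ≤ - ε)
    on-cube : P (Unit n) → ∃[ ε ] 0# < ε × (∀ x → g x ≤ - ε)
    on-cube (ε , 0<ε , g≤-ε) = ε , 0<ε , λ x → g≤-ε x λ i → Cube.0≤ x i , Cube.≤1 x i
    -‿antitone : ∀ {x y z} → x ≤ y → z ≤ - y → z ≤ - x
    -‿antitone {x} {y} {z} x≤y z≤-y = ≤-from (gap x≤y ⊞ gap z≤-y)
      (solve 3 (λ x y z → (y :- x) :+ (:- y :- z) := :- x :- z) refl x y z)
    ideal : IsIdeal P
    ideal .IsIdeal.down S⊆T (ε , 0<ε , g≤-ε) = ε , 0<ε , λ x x∈S → g≤-ε x (S⊆T x∈S)
    ideal .IsIdeal.union (δ , 0<δ , g≤-δ) (ε , 0<ε , g≤-ε) with lower-bound 0<δ 0<ε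
    ... | η , 0<η , η≤δ , η≤ε = η , 0<η , λ
      { x (inj₁ x∈S) → -‿antitone η≤δ (g≤-δ x x∈S)
      ; x (inj₂ x∈T) → -‿antitone η≤ε (g≤-ε x x∈T) }
    local : ∀ y → y ∈ Unit n → ∃[ δ ] 0# < δ × P (Near δ y)
    local y y∈U with half (gap< (g<0 (cube y (proj₁ ∘ y∈U) (proj₂ ∘ y∈U))))
    ... | h , 0<h , 2h≈-gy with continuous (cube y (proj₁ ∘ y∈U) (proj₂ ∘ y∈U)) h 0<h
    ...   | δ , 0<δ , near = δ , 0<δ , h , 0<h , λ x x-near →
      ≤-from (gap (<⇒≤ (proj₂ (near x x-near))))
        (trans (solve 3 (λ h a b → h :- (a :- b) := (h :+ h) :+ b :- h :- a) refl h (g x) _)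
          (trans (+-congʳ (+-congʳ (+-congʳ 2h≈-gy)))
            (solve 3 (λ h a b → (0ₚ :- b) :+ b :- h :- a := :- h :- a) refl h (g x) _)))

  common-bound : ∀ {k} {Q : Fin k → Pred Carrier 0ℓ} → (∀ i {δ ε} → δ ≤ ε → ε ∈ Q i → δ ∈ Q i) →
    (∀ i → ∃[ δ ] 0# < δ × δ ∈ Q i) → ∃[ δ ] 0# < δ × (∀ i → δ ∈ Q i)
  common-bound {zero}  antitone each = 1# , 0<1 , λ ()
  common-bound {suc k} antitone each with each zero | common-bound (antitone ∘ suc) (each ∘ suc)
  ... | δ , 0<δ , δ∈Q | ε , 0<ε , ε∈Q with lower-bound 0<δ 0<ε
  ...   | η , 0<η , η≤δ , η≤ε = η , 0<η , λ
    { zero → antitone zero η≤δ δ∈Q ; (suc i) → antitone (suc i) η≤ε (ε∈Q i) }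

  ∙-small : ∀ {k} (σ : Point k) {ε} → 0# < ε → ∃[ η ] 0# < η × (∀ {v} → Bounded η v → σ ∙ v < ε)
  ∙-small σ {ε} 0<ε with ∙-bound σ
  -- The summand 1 keeps the divisor positive even when M is 0; the same device recurs below with U.
  ... | M , 0≤M , bound with reciprocal (0≤M ⊞< 0<1)
  ...   | r , 0<r , [M+1]r≈1 = r * ε , 0<r ⊠< 0<ε , λ {v} v≤rε →
    ≤-<-trans (bound (<⇒≤ (0<r ⊠< 0<ε)) v≤rε) (<-from (0<r ⊠< 0<ε)
      (trans (solve 3 (λ M r ε → r :* ε := (M :+ 1ₚ) :* r :* ε :- M :* (r :* ε)) refl M r ε)
        (+-congʳ (trans (*-congʳ [M+1]r≈1) (*-identityˡ ε)))))

  ∙-continuous : ∀ {n k} (σ : Point k) {g : Cube n → Point k} → (∀ i → Continuous (λ x → g x i)) →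
    Continuous (λ x → σ ∙ g x)
  ∙-continuous {n} {k} σ {g} continuous x ε 0<ε = choose (∙-small σ 0<ε)
    where
    choose : ∃[ η ] 0# < η × (∀ {v} → Bounded η v → σ ∙ v < ε) →
             ∃[ δ ] 0# < δ × (∀ y → Near δ (pt x) (pt y) → Within ε (σ ∙ g x) (σ ∙ g y))
    choose (η , 0<η , small) = conclude (common-bound
      {Q = λ i δ → ∀ y → Near δ (pt x) (pt y) → Within η (g x i) (g y i)}
      (λ i δ≤ε near y y-near → near y (λ j → Within-mono δ≤ε (y-near j)))
      (λ i → continuous i x η 0<η))
      where
      bounded : ∀ {y z : Point k} → Near η y z → Bounded η (y ⊹ ⊝ z)
      bounded {y} {z} near i = <⇒≤ (proj₁ (near i)) ,
        ≤-from (gap (<⇒≤ (proj₂ (near i))))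
          (solve 3 (λ y z η → η :- (z :- y) := (y :- z) :- :- η) refl (y i) (z i) η)
      difference : ∀ {y z : Point k} → Near η y z → σ ∙ y - σ ∙ z < ε
      difference {y} {z} near = ≤-<-trans (≤-reflexive (sym (trans (∙-⊹ σ y (⊝ z)) (+-congˡ (∙-⊝ σ z)))))
        (small (bounded near))
      conclude : ∃[ δ ] 0# < δ × (∀ i y → Near δ (pt x) (pt y) → Within η (g x i) (g y i)) →
                 ∃[ δ ] 0# < δ × (∀ y → Near δ (pt x) (pt y) → Within ε (σ ∙ g x) (σ ∙ g y))
      conclude (δ , 0<δ , near) = δ , 0<δ , λ y y-near →
        difference (λ i → near i y y-near) , difference (λ i → proj₂ (near i y y-near) , proj₁ (near i y y-near))

-- Coherence and the closed convex hull.

module CoherentBooks (em : ExcludedMiddle 0ℓ) (ℝ : CompleteOrderedField) where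
  open CompleteOrderedField ℝ
  open Books ℝ
  open OrderedField em ℝ
  open ConvexCones em ℝ
  open GeneratedCones em ℝ
  open Compactness em ℝ

  module _ {k : ℕ} where

    near-trans : ∀ {δ ε} {x y z : Point k} → Near δ x y → Near ε y z → Near (δ + ε) x z
    near-trans {δ} {ε} {x} {y} {z} x~y y~z i =
      <-from (gap< (proj₁ (x~y i)) <⊞ gap (<⇒≤ (proj₁ (y~z i))))
        (solve 5 (λ δ ε x y z → (δ :- (x :- y)) :+ (ε :- (y :- z)) := δ :+ ε :- (x :- z)) refl
          δ ε (x i) (y i) (z i)) ,
      <-from (gap< (proj₂ (x~y i)) <⊞ gap (<⇒≤ (proj₂ (y~z i))))
        (solve 5 (λ δ ε x y z → (δ :- (y :- x)) :+ (ε :- (z :- y)) := δ :+ ε :- (z :- x)) refl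
          δ ε (x i) (y i) (z i))

    near-mono : ∀ {δ ε} {x y : Point k} → δ ≤ ε → Near δ x y → Near ε x y
    near-mono δ≤ε x~y i = Within-mono δ≤ε (x~y i)

    near-halves : ∀ {h ε} {x y z : Point k} → h + h ≈ ε → Near h x y → Near h y z → Near ε x z
    near-halves 2h≈ε x~y y~z = near-mono (≤-reflexive 2h≈ε) (near-trans x~y y~z)

    ≈ₚ⇒near : ∀ {ε} {x y : Point k} → 0# < ε → x ≈ₚ y → Near ε x y
    ≈ₚ⇒near 0<ε x≈y i =
      ≤-<-trans (≤-reflexive (trans (+-congʳ (x≈y i)) (-‿inverseʳ _))) 0<ε ,
      ≤-<-trans (≤-reflexive (trans (+-congʳ (sym (x≈y i))) (-‿inverseʳ _))) 0<ε

    near-⊝ : ∀ {ε} {x y : Point k} → Near ε x y → Near ε (⊝ x) (⊝ y)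
    near-⊝ {x = x} {y} x~y i =
      ≤-<-trans (≤-reflexive (solve 2 (λ x y → :- x :- :- y := y :- x) refl (x i) (y i))) (proj₂ (x~y i)) ,
      ≤-<-trans (≤-reflexive (solve 2 (λ x y → :- y :- :- x := x :- y) refl (x i) (y i))) (proj₁ (x~y i))

    near-⊹ : ∀ {δ ε} {x y z w : Point k} → Near δ x y → Near ε z w → Near (δ + ε) (x ⊹ z) (y ⊹ w)
    near-⊹ {δ} {ε} {x} {y} {z} {w} x~y z~w i =
      <-from (gap< (proj₁ (x~y i)) <⊞ gap (<⇒≤ (proj₁ (z~w i))))
        (rearranged (x i) (y i) (z i) (w i)) ,
      <-from (gap< (proj₂ (x~y i)) <⊞ gap (<⇒≤ (proj₂ (z~w i))))
        (rearranged (y i) (x i) (w i) (z i))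
      where
      rearranged : ∀ x y z w → (δ - (x - y)) + (ε - (z - w)) ≈ δ + ε - (x + z - (y + w))
      rearranged = solve 6 (λ δ ε x y z w → (δ :- (x :- y)) :+ (ε :- (z :- w)) :=
        δ :+ ε :- (x :+ z :- (y :+ w))) refl δ ε

    near-⊛ : ∀ {δ ε t} {x y : Point k} → 0# ≤ t → 0# < δ → (t + 1#) * δ ≈ ε → Near δ x y → Near ε (t ⊛ x) (t ⊛ y)
    near-⊛ {δ} {ε} {t} {x} {y} 0≤t 0<δ ε≈ x~y i =
      scaled (x i) (y i) (proj₁ (x~y i)) , scaled (y i) (x i) (proj₂ (x~y i))
      where
      scaled : ∀ x y → x - y < δ → t * x - t * y < ε
      scaled x y x-y<δ = <-from (0<δ <⊞ 0≤t ⊠ gap (<⇒≤ x-y<δ))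
        (trans (solve 4 (λ t δ x y → δ :+ t :* (δ :- (x :- y)) := (t :+ 1ₚ) :* δ :- (t :* x :- t :* y)) refl t δ x y)
          (+-congʳ ε≈))

    closure-closed : ∀ {S : Pred (Point k) 0ℓ} → closure (closure S) ⊆ closure S
    closure-closed y∈S̄ ε 0<ε with half 0<ε
    ... | h , 0<h , 2h≈ε with y∈S̄ h 0<h
    ...   | z , z∈S̄ , y~z with z∈S̄ h 0<h
    ...     | w , w∈S , z~w = w , w∈S , near-halves 2h≈ε y~z z~w

    ⊆-closure : ∀ {S : Pred (Point k) 0ℓ} {x y} → x ≈ₚ y → y ∈ S → x ∈ closure S
    ⊆-closure {y = y} x≈y y∈S ε 0<ε = y , y∈S , ≈ₚ⇒near 0<ε x≈y

    -- A ball of radius ε around y contains the ball of radius ε/2 around any z within ε/2 of y. If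
    -- y were relatively interior, so would be the boundary points near it.
    relativeBoundary-closed : ∀ {S : Pred (Point k) 0ℓ} → closure S ⊆ S →
      closure (relativeBoundary S) ⊆ relativeBoundary S
    relativeBoundary-closed {S} closed {y} y∈rb =
      closure-closed (λ ε 0<ε → member (y∈rb ε 0<ε)) , λ { (_ , ε , 0<ε , ball) → not-interior 0<ε ball (half 0<ε) }
      where
      member : ∀ {ε} → ∃[ z ] z ∈ relativeBoundary S × Near ε y z → ∃[ z ] z ∈ closure S × Near ε y z
      member (z , (z∈S̄ , _) , y~z) = z , z∈S̄ , y~z
      not-interior : ∀ {ε} → 0# < ε → (∀ z → z ∈ affineHull S → Near ε y z → z ∈ S) →
                     ∃[ h ] 0# < h × h + h ≈ ε → ⊥
      not-interior 0<ε ball (h , 0<h , 2h≈ε) with y∈rb h 0<h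
      ... | z , (z∈S̄ , z∉ri) , y~z = z∉ri
        (closed z∈S̄ , h , 0<h , λ w w∈aff z~w → ball w w∈aff (near-halves 2h≈ε y~z z~w))

    closure-⊹ : ∀ {S : Pred (Point k) 0ℓ} → (∀ {x y} → x ∈ S → y ∈ S → x ⊹ y ∈ S) →
      ∀ {x y} → x ∈ closure S → y ∈ closure S → x ⊹ y ∈ closure S
    closure-⊹ S-⊹ x∈S̄ y∈S̄ ε 0<ε with half 0<ε
    ... | h , 0<h , 2h≈ε with x∈S̄ h 0<h | y∈S̄ h 0<h
    ...   | z , z∈S , x~z | w , w∈S , y~w =
      z ⊹ w , S-⊹ z∈S w∈S , near-mono (≤-reflexive 2h≈ε) (near-⊹ x~z y~w)

    closure-⊝ : ∀ {S : Pred (Point k) 0ℓ} → (∀ {x} → x ∈ S → ⊝ x ∈ S) → ∀ {x} → x ∈ closure S → ⊝ x ∈ closure S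
    closure-⊝ S-⊝ x∈S̄ ε 0<ε with x∈S̄ ε 0<ε
    ... | z , z∈S , x~z = ⊝ z , S-⊝ z∈S , near-⊝ x~z

    closure-⊛ : ∀ {S : Pred (Point k) 0ℓ} {t} → 0# ≤ t → (∀ {x} → x ∈ S → t ⊛ x ∈ S) →
      ∀ {x} → x ∈ closure S → t ⊛ x ∈ closure S
    closure-⊛ {t = t} 0≤t S-⊛ x∈S̄ ε 0<ε with reciprocal (0≤t ⊞< 0<1)
    ... | r , 0<r , [t+1]r≈1 with x∈S̄ (r * ε) (0<r ⊠< 0<ε)
    ...   | z , z∈S , x~z = t ⊛ z , S-⊛ z∈S , near-⊛ 0≤t (0<r ⊠< 0<ε)
      (trans (sym (*-assoc _ _ _)) (trans (*-congʳ [t+1]r≈1) (*-identityˡ ε))) x~z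

    closure-resp : ∀ {S : Pred (Point k) 0ℓ} {x y} → x ≈ₚ y → x ∈ closure S → y ∈ closure S
    closure-resp x≈y x∈S̄ = closure-closed (⊆-closure (λ i → sym (x≈y i)) x∈S̄)

  origin-cube : ∀ {n} → Cube n
  origin-cube = cube 𝟎 (λ i → ≤-refl) (λ i → 0≤1)

  module _ {n k : ℕ} (Φ : Fin k → 𝐅 n) (β : Cube k) where

    private
      value net : Cube n → Point k
      value x i = fn (Φ i) x
      net x i = pt β i - value x i

      hull : Pred (Point k) 0ℓ
      hull = convexHull (range Φ)

    -- β carries the factor `sum t` so that the induction can run over tails, whose coefficients no
    -- longer sum to 1.
    combination⇒cone : ∀ m (t : Vector Carrier m) (q : Vector (Point k) m) →
      (∀ j → 0# ≤ t j) → (∀ j → q j ∈ range Φ) →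
      Cone net (sum t) (λ i → sum t * pt β i - sum λ j → t j * q j i)
    combination⇒cone zero    t q 0≤t q∈ = nil refl λ i →
      solve 1 (λ b → 0ₚ :* b :- 0ₚ := 0ₚ) refl (pt β i)
    combination⇒cone (suc m) t q 0≤t q∈ with q∈ zero
    ... | x , q₀≈fx = cons x (0≤t zero) (combination⇒cone m (tail t) (tail q) (0≤t ∘ suc) (q∈ ∘ suc)) refl λ i →
      trans (+-congˡ (-‿cong (+-congʳ (*-congˡ (q₀≈fx i)))))
        (solve 5 (λ t T b f S → (t :+ T) :* b :- (t :* f :+ S) := t :* (b :- f) :+ (T :* b :- S)) refl
          (t zero) (sum (tail t)) (pt β i) (value x i) (sum λ j → t (suc j) * q (suc j) i))

    cone⇒combination : ∀ {c v} → Cone net c v → ∃[ m ] Σ (Vector Carrier m) λ t → Σ (Vector (Point k) m) λ q →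
      (∀ j → 0# ≤ t j) × (∀ j → q j ∈ range Φ) × sum t ≈ c ×
      (∀ i → c * pt β i - v i ≈ sum λ j → t j * q j i)
    cone⇒combination (nil {c} {v} c≈0 v≈0) = 0 , [] , [] , (λ ()) , (λ ()) , sym c≈0 , λ i →
      trans (+-cong (*-congʳ c≈0) (-‿cong (v≈0 i))) (solve 1 (λ b → 0ₚ :* b :- 0ₚ := 0ₚ) refl (pt β i))
    cone⇒combination (cons {t} {c} {_} {v} x 0≤t C c≈ v≈) with cone⇒combination C
    ... | m , ts , qs , 0≤ts , qs∈ , sum≈ , point≈ = suc m , t ∷ ts , value x ∷ qs ,
      (λ { zero → 0≤t ; (suc j) → 0≤ts j }) , (λ { zero → x , (λ i → refl) ; (suc j) → qs∈ j }) ,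
      trans (+-congˡ sum≈) (sym c≈) , λ i →
      trans (+-cong (*-congʳ c≈) (-‿cong (v≈ i)))
        (trans (solve 5 (λ t c b f v → (t :+ c) :* b :- (t :* (b :- f) :+ v) := t :* f :+ (c :* b :- v)) refl
                 t c (pt β i) (value x i) (v i))
          (+-congˡ (point≈ i)))

    -- With its converse `cone⇒hull` this identifies the hull, reflected through β, with the vectors
    -- of weight 1, which is what weights are recorded for.
    hull⇒cone : ∀ {p} → p ∈ hull → Cone net 1# (pt β ⊹ ⊝ p)
    hull⇒cone (m , t , q , 0≤t , q∈ , sum≈1 , p≈) = cone-resp sum≈1
      (λ i → +-cong (trans (*-congʳ sum≈1) (*-identityˡ _)) (-‿cong (sym (p≈ i))))
      (combination⇒cone m t q 0≤t q∈)

    cone⇒hull : ∀ {v} → Cone net 1# v → pt β ⊹ ⊝ v ∈ hull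
    cone⇒hull {v} C with cone⇒combination C
    ... | m , t , q , 0≤t , q∈ , sum≈1 , p≈ =
      m , t , q , 0≤t , q∈ , sum≈1 , λ i → trans (+-congʳ (sym (*-identityˡ _))) (p≈ i)

    value∈𝒞 : ∀ x → value x ∈ 𝒞 Φ
    value∈𝒞 x = ⊆-closure
      (λ i → solve 2 (λ b f → f := b :- (b :- f)) refl (pt β i) (value x i))
      (cone⇒hull (generator x))

    -- On the hull the bound is `cone-≤` at weight 1; a violation at a limit point y would persist
    -- at hull points close to y.
    halfspace : ∀ σ {a} → (∀ x → balance Φ β σ x ≤ a) → ∀ {y} → y ∈ 𝒞 Φ → σ ∙ (pt β ⊹ ⊝ y) ≤ a
    halfspace σ {a} σ≤a {y} y∈𝒞 = ≮⇒≥ λ a<σy → contradict a<σy (∙-small σ (gap< a<σy))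
      where
      contradict : a < σ ∙ (pt β ⊹ ⊝ y) →
        ∃[ η ] 0# < η × (∀ {v} → Bounded η v → σ ∙ v < σ ∙ (pt β ⊹ ⊝ y) - a) → ⊥
      contradict a<σy (η , 0<η , small) with y∈𝒞 η 0<η
      ... | z , z∈hull , y~z = <⇒≱
        (<-from (gap< (small bounded) <⊞ gap (cone-≤ σ σ≤a (hull⇒cone z∈hull)))
          (trans (solve 4 (λ a p q r → (r :- a :- q) :+ (a :* 1ₚ :- p) := r :- (p :+ q)) refl
                   a (σ ∙ (pt β ⊹ ⊝ z)) (σ ∙ (z ⊹ ⊝ y)) (σ ∙ (pt β ⊹ ⊝ y)))
            (+-congˡ (-‿cong (sym (∙-⊹ σ (pt β ⊹ ⊝ z) (z ⊹ ⊝ y)))))))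
        (≤-reflexive (∙-congˡ σ λ i →
          solve 3 (λ b y z → b :- y := b :- z :+ (z :- y)) refl (pt β i) (y i) (z i)))
        where
        bounded : Bounded η (z ⊹ ⊝ y)
        bounded i = <⇒≤ (proj₂ (y~z i)) ,
          ≤-from (gap (<⇒≤ (proj₁ (y~z i)))) (solve 3 (λ y z η → η :- (y :- z) := z :- y :- :- η) refl (y i) (z i) η)

    ∈𝒞⇒coherent : pt β ∈ 𝒞 Φ → Coherent Φ β
    ∈𝒞⇒coherent β∈𝒞 (σ , balance<0) =
      contradict (negative-continuous (∙-continuous σ {net} net-continuous) balance<0)
      where
      net-continuous : ∀ i → Continuous (λ x → net x i)
      net-continuous i x ε 0<ε with 𝐅.continuous (Φ i) x ε 0<ε
      ... | δ , 0<δ , near = δ , 0<δ , λ y x~y →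
        ≤-<-trans (≤-reflexive (swapped (value x i) (value y i))) (proj₂ (near y x~y)) ,
        ≤-<-trans (≤-reflexive (swapped (value y i) (value x i))) (proj₁ (near y x~y))
        where
        swapped : ∀ a b → pt β i - a - (pt β i - b) ≈ b - a
        swapped = solve 3 (λ c a b → c :- a :- (c :- b) := b :- a) refl (pt β i)
      contradict : ∃[ ε ] 0# < ε × (∀ x → balance Φ β σ x ≤ - ε) → ⊥
      -- At y = β the half-space inequality reads 0 ≤ - ε.
      contradict (ε , 0<ε , balance≤-ε) = <⇒≱ 0<ε (≤-from (gap (halfspace σ balance≤-ε β∈𝒞))
        (trans (+-congˡ (-‿cong (trans (∙-congˡ σ λ i → -‿inverseʳ (pt β i)) (∙-𝟎 σ))))
          (solve 1 (λ ε → :- ε :- 0ₚ := 0ₚ :- ε) refl ε)))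

    -- For s = ε / (U + 1) the vector s y has size at most ε, so each generator minus s y stays in
    -- the thick cone. Hence σ is at least s (σ ∙ y) > 0 on all generators, and the stakes - σ lose
    -- everywhere.
    thick-supported⇒incoherent : ∀ {ε} → 0# < ε → Supported (Thick {b = net} ε) → ¬ Coherent Φ β
    thick-supported⇒incoherent {ε} 0<ε (σ , σ≥0 , c , y , _ , 0<σ∙y) coherent = refute (norm y)
      where
      refute : ∃[ U ] 0# ≤ U × Bounded U y → ⊥
      refute (U , 0≤U , y≤U) with reciprocal (0≤U ⊞< 0<1)
      ... | r , 0<r , [U+1]r≈1 = coherent (⊝ σ , λ x →
        ≤-<-trans (≤-reflexive (⊝-∙ σ (net x)))
          (<-from (negative x) (solve 1 (λ p → p := 0ₚ :- :- p) refl (σ ∙ net x))))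
        where
        s : Carrier
        s = ε * r
        0<s : 0# < s
        0<s = 0<ε ⊠< 0<r
        sU≤ε : s * U ≤ ε * 1#
        sU≤ε = ≤-from (<⇒≤ 0<s) (trans (solve 3 (λ ε r U → ε :* r := ε :* ((U :+ 1ₚ) :* r) :- ε :* r :* U) refl ε r U)
          (+-congʳ (*-congˡ [U+1]r≈1)))
        shifted : ∀ x → Thick ε 1# (net x ⊹ ⊝ (s ⊛ y))
        shifted x = net x , generator x , bounded-resp refl
          (λ i → solve 2 (λ b p → :- p := b :+ :- p :+ :- b) refl (net x i) (s * y i))
          (bounded-mono sU≤ε (bounded-⊝ (bounded-⊛ (<⇒≤ 0<s) y≤U)))
        negative : ∀ x → 0# < σ ∙ net x
        negative x = <-≤-trans (0<s ⊠< 0<σ∙y) (≤-from (σ≥0 (shifted x))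
          (trans (∙-⊹ σ (net x) (⊝ (s ⊛ y))) (+-congˡ (trans (∙-⊝ σ (s ⊛ y)) (-‿cong (∙-⊛ σ s y))))))

    -- The opposite of a generator q is within ε d of some cone vector p of weight d. Then (q + p) /
    -- (1 + d) has weight 1 and size at most ε d / (1 + d) < ε, so subtracting it from β gives a
    -- nearby point of the hull.
    thick-symmetric⇒near : ∀ {ε} → 0# < ε → Symmetric (Thick {b = net} ε) → ∃[ z ] z ∈ hull × Near ε (pt β) z
    thick-symmetric⇒near {ε} 0<ε symmetric = from-opposite (symmetric
      (net o , generator o , bounded-resp refl (λ i → sym (-‿inverseʳ (net o i)))
        (λ i → ≤-trans (<⇒≤ 0<ε) (≤-reflexive (sym (trans (*-comm _ _) (*-identityˡ ε)))) ,
               ≤-from (<⇒≤ 0<ε) (solve 1 (λ ε → ε := 0ₚ :- :- (ε :* 1ₚ)) refl ε))))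
      where
      o : Cube n
      o = origin-cube
      from-opposite : ∃[ d ] Thick ε d (⊝ net o) → ∃[ z ] z ∈ hull × Near ε (pt β) z
      from-opposite (d , p , Cp , near) with reciprocal (0<1 <⊞ cone-weight Cp)
      ... | r , 0<r , [1+d]r≈1 = _ , cone⇒hull average , close
        where
        v : Point k
        v = r ⊛ (net o ⊹ p)
        average : Cone net 1# v
        average = cone-resp (trans (*-comm _ _) [1+d]r≈1) (λ i → refl)
          (cone-scale (<⇒≤ 0<r) (cone-add (generator o) Cp))
        close : Near ε (pt β) (pt β ⊹ ⊝ v)
        close i =
          <-from (0<ε ⊠< 0<r <⊞ <⇒≤ 0<r ⊠ gap (proj₂ (near i)))
            (trans (solve 6 (λ ε r d b q p → ε :* r :+ r :* ((:- q :- p) :- :- (ε :* d)) :=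
                       ε :* ((1ₚ :+ d) :* r) :- (b :- (b :- r :* (q :+ p)))) refl ε r d (pt β i) (net o i) (p i))
              (+-congʳ (trans (*-congˡ [1+d]r≈1) (trans (*-comm _ _) (*-identityˡ ε))))) ,
          <-from (0<ε ⊠< 0<r <⊞ <⇒≤ 0<r ⊠ gap (proj₁ (near i)))
            (trans (solve 6 (λ ε r d b q p → ε :* r :+ r :* (ε :* d :- (:- q :- p)) :=
                       ε :* ((1ₚ :+ d) :* r) :- (b :- r :* (q :+ p) :- b)) refl ε r d (pt β i) (net o i) (p i))
              (+-congʳ (trans (*-congˡ [1+d]r≈1) (trans (*-comm _ _) (*-identityˡ ε)))))

    coherent⇒∈𝒞 : Coherent Φ β → pt β ∈ 𝒞 Φ
    coherent⇒∈𝒞 coherent ε 0<ε = choose (supported-or-symmetric (thick (<⇒≤ 0<ε)))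
      where
      choose : Symmetric (Thick {b = net} ε) ⊎ Supported (Thick {b = net} ε) → ∃[ z ] z ∈ hull × Near ε (pt β) z
      choose (inj₁ symmetric) = thick-symmetric⇒near 0<ε symmetric
      choose (inj₂ supported) = ⊥-elim (thick-supported⇒incoherent 0<ε supported coherent)

-- Strict coherence and the relative interior.

module StrictlyCoherentBooks (em : ExcludedMiddle 0ℓ) (ℝ : CompleteOrderedField) where
  open CompleteOrderedField ℝ
  open Books ℝ
  open OrderedField em ℝ
  open ConvexCones em ℝ
  open GeneratedCones em ℝ
  open Compactness em ℝ
  open CoherentBooks em ℝ

  module _ {n k : ℕ} (Φ : Fin k → 𝐅 n) (β : Cube k) where

    private
      net : Cube n → Point k
      net x i = pt β i - fn (Φ i) x

      K : Pred (Point k) 0ℓ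
      K y = ∃[ c ] Cone net c y

    strictlyCoherent⇒coherent : StrictlyCoherent Φ β → Coherent Φ β
    strictlyCoherent⇒coherent strict (σ , balance<0) with strict σ (origin-cube , balance<0 origin-cube)
    ... | x , 0<balance = <⇒≱ 0<balance (<⇒≤ (balance<0 x))

    -- For a support functional σ the stakes - σ never win, so by strictness they never lose. Then σ
    -- vanishes on the generators and hence on the cone, against the choice of σ.
    strictlyCoherent⇒symmetric : StrictlyCoherent Φ β → Symmetric (Cone net)
    strictlyCoherent⇒symmetric strict = choose (supported-or-symmetric generated)
      where
      unsupported : ¬ Supported (Cone net)
      unsupported (σ , σ≥0 , c , y , Cy , 0<σ∙y) = <⇒≱ 0<σ∙y (≤-respʳ-≈ (zeroˡ c) (cone-≤ σ nonpositive Cy))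
        where
        losing : ∀ x → ¬ 0# < ⊝ σ ∙ net x
        losing x 0<-σ∙b = <⇒≱ 0<-σ∙b (≤-from (σ≥0 (generator x))
          (trans (solve 1 (λ p → p := 0ₚ :- :- p) refl (σ ∙ net x)) (+-congˡ (-‿cong (sym (⊝-∙ σ (net x)))))))
        nonpositive : ∀ x → σ ∙ net x ≤ 0#
        nonpositive x = ≮⇒≥ λ 0<σ∙b → lost (strict (⊝ σ) (x , <-from 0<σ∙b
          (trans (solve 1 (λ p → p := 0ₚ :- :- p) refl (σ ∙ net x)) (+-congˡ (-‿cong (sym (⊝-∙ σ (net x))))))))
          where
          lost : ¬ (∃[ x′ ] 0# < ⊝ σ ∙ net x′)
          lost (x′ , 0<-σ∙b) = losing x′ 0<-σ∙b
      choose : Symmetric (Cone net) ⊎ Supported (Cone net) → Symmetric (Cone net)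
      choose (inj₁ symmetric) = symmetric
      choose (inj₂ supported) = ⊥-elim (unsupported supported)

    module _ (symmetric : Symmetric (Cone net)) where

      closure-K-⊛ : ∀ t {y} → y ∈ closure K → t ⊛ y ∈ closure K
      closure-K-⊛ t {y} y∈ with total 0# t
      ... | inj₁ 0≤t = closure-⊛ 0≤t (λ { (c , C) → t * c , cone-scale 0≤t C }) y∈
      ... | inj₂ t≤0 = closure-resp (λ i → solve 2 (λ t y → (0ₚ :- t) :* :- y := t :* y) refl t (y i))
        (closure-⊛ (gap t≤0) (λ { (c , C) → (0# - t) * c , cone-scale (gap t≤0) C })
          (closure-⊝ (λ { (c , C) → symmetric C }) y∈))

      -- For p in 𝒞 the vector β - p is only a limit of cone vectors. The closure of K absorbs these
      -- limits, and symmetry allows the negative coefficients of affine combinations.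
      combination∈closure-K : ∀ m (t : Vector Carrier m) (p : Vector (Point k) m) → (∀ j → p j ∈ 𝒞 Φ) →
        (λ i → sum t * pt β i - sum λ j → t j * p j i) ∈ closure K
      combination∈closure-K zero    t p p∈ = ⊆-closure
        (λ i → solve 1 (λ b → 0ₚ :* b :- 0ₚ := 0ₚ) refl (pt β i)) (0# , WeightedCone.origin generated)
      combination∈closure-K (suc m) t p p∈ = closure-resp
        (λ i → solve 5 (λ t T b q S → t :* (b :- q) :+ (T :* b :- S) := (t :+ T) :* b :- (t :* q :+ S)) refl
          (t zero) (sum (tail t)) (pt β i) (p zero i) (sum λ j → t (suc j) * p (suc j) i))
        (closure-⊹ (λ { (c , C) (d , D) → c + d , cone-add C D })
          (closure-K-⊛ (t zero) direction) (combination∈closure-K m (tail t) (tail p) (p∈ ∘ suc)))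
        where
        direction : pt β ⊹ ⊝ p zero ∈ closure K
        direction ε 0<ε with p∈ zero ε 0<ε
        ... | z , z∈hull , p~z = _ , (1# , hull⇒cone Φ β z∈hull) , λ i →
          ≤-<-trans (≤-reflexive (swapped i (p zero i) (z i))) (proj₂ (p~z i)) ,
          ≤-<-trans (≤-reflexive (swapped i (z i) (p zero i))) (proj₁ (p~z i))
          where
          swapped : ∀ i a b → pt β i - a - (pt β i - b) ≈ b - a
          swapped i = solve 3 (λ c a b → c :- a :- (c :- b) := b :- a) refl (pt β i)

      affineHull⊆closure-K : ∀ {z} → z ∈ affineHull (𝒞 Φ) → pt β ⊹ ⊝ z ∈ closure K
      affineHull⊆closure-K (m , t , p , p∈ , sum≈1 , z≈) = closure-resp
        (λ i → +-cong (trans (*-congʳ sum≈1) (*-identityˡ _)) (-‿cong (sym (z≈ i))))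
        (combination∈closure-K m t p p∈)

      -- A generator plus its opposite represents 0 with weight 1 + d > 0, which rescales to any t.
      -- Adding such a representation raises a weight without moving the vector.
      weightless : ∀ {t} → 0# ≤ t → Cone net t 𝟎
      weightless {t} 0≤t = from-opposite (symmetric (generator o))
        where
        o : Cube n
        o = origin-cube
        from-opposite : ∃[ d ] Cone net d (⊝ net o) → Cone net t 𝟎
        from-opposite (d , D) with reciprocal (0<1 <⊞ cone-weight D)
        ... | r , 0<r , [1+d]r≈1 = cone-resp
          (trans (*-assoc t r _) (trans (*-congˡ (trans (*-comm r _) [1+d]r≈1)) (trans (*-comm t 1#) (*-identityˡ t))))
          (λ i → trans (*-congˡ (-‿inverseʳ (net o i))) (zeroʳ _))
          (cone-scale (0≤t ⊠ <⇒≤ 0<r) (cone-add (generator o) D))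

      -- At size 1 / (M + 1) some representation has weight at most M / (M + 1) < 1, and
      -- `weightless` fills it up to exactly 1.
      small⇒hull : ∃[ η ] 0# < η × (∀ {v} → v ∈ K → Bounded η v → pt β ⊹ ⊝ v ∈ convexHull (range Φ))
      small⇒hull with weight-bound generated symmetric
      ... | M , 0≤M , bound with reciprocal (0≤M ⊞< 0<1)
      ...   | r , 0<r , [M+1]r≈1 = r , 0<r , λ { (c , C) v≤r → cone⇒hull Φ β (fill (bound C v≤r)) }
        where
        fill : ∀ {v} → ∃[ d ] Cone net d v × d ≤ M * r → Cone net 1# v
        fill (d , D , d≤Mr) = cone-resp (solve 1 (λ d → d :+ (1ₚ :- d) := 1ₚ) refl d) (λ i → +-identityʳ _)
          (cone-add D (weightless (≤-from (gap d≤Mr ⊞ <⇒≤ 0<r)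
            (trans (solve 3 (λ M r d → M :* r :- d :+ r := (M :+ 1ₚ) :* r :- d :- 0ₚ) refl M r d)
              (+-congʳ (+-congʳ [M+1]r≈1))))))

      -- For z within h = η/2 of β, approximate β - z by v in K with error e. As e ≤ h, v has size
      -- at most η, so β - v lies in the hull; it is within e of z, and e can be made as small as
      -- desired.
      symmetric⇒relativeInterior : pt β ∈ 𝒞 Φ → pt β ∈ relativeInterior (𝒞 Φ)
      symmetric⇒relativeInterior β∈𝒞 = β∈𝒞 , radius small⇒hull
        where
        radius : ∃[ η ] 0# < η × (∀ {v} → v ∈ K → Bounded η v → pt β ⊹ ⊝ v ∈ convexHull (range Φ)) →
                 ∃[ ε ] 0# < ε × (∀ z → z ∈ affineHull (𝒞 Φ) → Near ε (pt β) z → z ∈ 𝒞 Φ)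
        radius (η , 0<η , small) with half 0<η
        ... | h , 0<h , 2h≈η = h , 0<h , λ z z∈aff β~z ε 0<ε →
          approximate z β~z (affineHull⊆closure-K z∈aff) (lower-bound 0<ε 0<h)
          where
          approximate : ∀ z → Near h (pt β) z → pt β ⊹ ⊝ z ∈ closure K →
            ∀ {ε} → ∃[ e ] 0# < e × e ≤ ε × e ≤ h → ∃[ w ] w ∈ convexHull (range Φ) × Near ε z w
          approximate z β~z β-z∈ (e , 0<e , e≤ε , e≤h) with β-z∈ e 0<e
          ... | v , v∈K , β-z~v = pt β ⊹ ⊝ v , small v∈K bounded , λ i →
            <-≤-trans (≤-<-trans (≤-reflexive (solve 3 (λ b z v → z :- (b :- v) := v :- (b :- z)) refl
              (pt β i) (z i) (v i))) (proj₂ (β-z~v i))) e≤ε ,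
            <-≤-trans (≤-<-trans (≤-reflexive (solve 3 (λ b z v → b :- v :- z := b :- z :- v) refl
              (pt β i) (z i) (v i))) (proj₁ (β-z~v i))) e≤ε
            where
            bounded : Bounded η v
            bounded = bounded-resp 2h≈η (λ i → refl) λ i →
              ≤-from (gap (<⇒≤ (proj₁ (β~z i))) ⊞ gap (<⇒≤ (proj₂ (β-z~v i))) ⊞ gap e≤h)
                (solve 5 (λ h e b z v → (h :- (b :- z)) :+ (e :- (v :- (b :- z))) :+ (h :- e) := h :+ h :- v) refl
                  h e (pt β i) (z i) (v i)) ,
              ≤-from (gap (<⇒≤ (proj₂ (β~z i))) ⊞ gap (<⇒≤ (proj₁ (β-z~v i))) ⊞ gap e≤h)
                (solve 5 (λ h e b z v → (h :- (z :- b)) :+ (e :- ((b :- z) :- v)) :+ (h :- e) := v :- :- (h :+ h)) refl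
                  h e (pt β i) (z i) (v i))

    strictlyCoherent⇒relativeInterior : StrictlyCoherent Φ β → pt β ∈ relativeInterior (𝒞 Φ)
    strictlyCoherent⇒relativeInterior strict =
      symmetric⇒relativeInterior (strictlyCoherent⇒symmetric strict)
        (coherent⇒∈𝒞 Φ β (strictlyCoherent⇒coherent strict))

    -- Step from β away from f(x), to z = (1 + s) β - s f(x), with s small enough for z to stay in
    -- 𝒞. If σ never won, `halfspace` would give σ ∙ (β - z) ≤ 0, but this number is - s times the
    -- negative balance at x.
    relativeInterior⇒strictlyCoherent : pt β ∈ relativeInterior (𝒞 Φ) → StrictlyCoherent Φ β
    relativeInterior⇒strictlyCoherent (β∈𝒞 , ε , 0<ε , ball) σ (x , σ∙b<0) =
      by-contradiction λ no-gain → refute no-gain (norm (net x))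
      where
      refute : ¬ (∃[ x′ ] 0# < balance Φ β σ x′) → ¬ (∃[ U ] 0# ≤ U × Bounded U (net x))
      refute no-gain (U , 0≤U , b≤U) with reciprocal (0≤U ⊞< 0<1)
      ... | r , 0<r , [U+1]r≈1 = <⇒≱ (s>0 ⊠< gap< σ∙b<0)
        (≤-respˡ-≈ (trans (∙-congˡ σ λ i → solve 3 (λ b s v → b :- (b :+ s :* v) := :- (s :* v)) refl (pt β i) s (net x i))
            (trans (∙-⊝ σ (s ⊛ net x)) (trans (-‿cong (∙-⊛ σ s (net x)))
              (solve 2 (λ s p → :- (s :* p) := s :* (0ₚ :- p)) refl s (σ ∙ net x)))))
          (halfspace Φ β σ (λ x′ → ≮⇒≥ λ 0<b → no-gain (x′ , 0<b)) z∈𝒞))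
        where
        s : Carrier
        s = ε * r
        s>0 : 0# < s
        s>0 = 0<ε ⊠< 0<r
        z : Point k
        z i = pt β i + s * net x i
        t : Vector Carrier 2
        t = 1# + s ∷ (- s ∷ [])
        p : Vector (Point k) 2
        p = pt β ∷ ((λ i → fn (Φ i) x) ∷ [])
        z∈aff : z ∈ affineHull (𝒞 Φ)
        z∈aff = 2 , t , p , (λ { zero → β∈𝒞 ; (suc zero) → value∈𝒞 Φ β x }) ,
          solve 1 (λ s → (1ₚ :+ s) :+ (:- s :+ 0ₚ) := 1ₚ) refl s ,
          λ i → solve 3 (λ b s f → b :+ s :* (b :- f) := (1ₚ :+ s) :* b :+ (:- s :* f :+ 0ₚ)) refl
            (pt β i) s (fn (Φ i) x)
        near : Near ε (pt β) z
        near i =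
          <-from (s>0 <⊞ <⇒≤ s>0 ⊠ gap (proj₂ (b≤U i)))
            (trans (solve 5 (λ ε r U b v → ε :* r :+ ε :* r :* (v :- :- U) :=
                       ε :* ((U :+ 1ₚ) :* r) :- (b :- (b :+ ε :* r :* v))) refl ε r U (pt β i) (net x i))
              (+-congʳ normalized)) ,
          <-from (s>0 <⊞ <⇒≤ s>0 ⊠ gap (proj₁ (b≤U i)))
            (trans (solve 5 (λ ε r U b v → ε :* r :+ ε :* r :* (U :- v) :=
                       ε :* ((U :+ 1ₚ) :* r) :- (b :+ ε :* r :* v :- b)) refl ε r U (pt β i) (net x i))
              (+-congʳ normalized))
          where
          normalized : ε * ((U + 1#) * r) ≈ ε
          normalized = trans (*-congˡ [U+1]r≈1) (trans (*-comm ε 1#) (*-identityˡ ε))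
        z∈𝒞 : z ∈ 𝒞 Φ
        z∈𝒞 = ball z z∈aff near

theorem5p5 : ExcludedMiddle 0ℓ → (ℝ : CompleteOrderedField) → let open Books ℝ in
    ∀ {n k} → 1 ≤ℕ n →
    (Φ : Fin k → 𝐅 n) → Injective _≡_ _≈ᶠ_ Φ →
    (β : Cube k) → Rational β →
    (ΠΦ ΠrbΦ Πβ : Formula k) →
    Axiomatizes ΠΦ (Th (𝒞 Φ)) →
    Axiomatizes ΠrbΦ (Th (rb𝒞 Φ)) →
    Axiomatizes Πβ (Th (singleton (pt β))) →
    (Coherent Φ β ⇔ (∃[ m ] (NonZero m × (⊢ Πβ ^ m ⇒ ΠΦ))))
    ×
    (StrictlyCoherent Φ β ⇔
    ((∃[ m ] (NonZero m × (⊢ Πβ ^ m ⇒ ΠΦ))) ×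
    (∀ m → NonZero m → ¬ (⊢ Πβ ^ m ⇒ ΠrbΦ))))
theorem5p5 em ℝ {n} {k} _ Φ _ β _ ΠΦ ΠrbΦ Πβ Φ-axiom rb-axiom β-axiom =
  mk⇔ (∈⇒derivable ∘ coherent⇒∈𝒞 Φ β) (∈𝒞⇒coherent Φ β ∘ derivable⇒∈) ,
  mk⇔ strict⇒derivable derivable⇒strict
  where
  open Books ℝ
  open OrderedField em ℝ using (by-contradiction)
  open Semantics em ℝ
  open CoherentBooks em ℝ
  open StrictlyCoherentBooks em ℝ

  Derivable : Formula k → Set
  Derivable π = ∃[ m ] (NonZero m × (⊢ Πβ ^ m ⇒ π))

  𝒞-closed : closure (𝒞 Φ) ⊆ 𝒞 Φ
  𝒞-closed = closure-closed

  ∈⇒derivable : pt β ∈ 𝒞 Φ → Derivable ΠΦ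
  ∈⇒derivable = ∈⇒implication 𝒞-closed β Φ-axiom β-axiom

  derivable⇒∈ : Derivable ΠΦ → pt β ∈ 𝒞 Φ
  derivable⇒∈ = implication⇒∈ 𝒞-closed β Φ-axiom β-axiom

  strict⇒derivable : StrictlyCoherent Φ β →
    Derivable ΠΦ × (∀ m → NonZero m → ¬ (⊢ Πβ ^ m ⇒ ΠrbΦ))
  strict⇒derivable strict = ∈⇒derivable (coherent⇒∈𝒞 Φ β (strictlyCoherent⇒coherent Φ β strict)) ,
    λ m m≢0 ⊢rb → β∉rb (implication⇒∈ (relativeBoundary-closed 𝒞-closed) β rb-axiom β-axiom (m , m≢0 , ⊢rb))
    where
    β∉rb : pt β ∉ rb𝒞 Φ
    β∉rb (_ , β∉ri) = β∉ri (strictlyCoherent⇒relativeInterior Φ β strict)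

  derivable⇒strict : Derivable ΠΦ × (∀ m → NonZero m → ¬ (⊢ Πβ ^ m ⇒ ΠrbΦ)) → StrictlyCoherent Φ β
  derivable⇒strict (⊢Φ , ⊬rb) = relativeInterior⇒strictlyCoherent Φ β
    (by-contradiction λ β∉ri → refute (β∈𝒞̄ , β∉ri))
    where
    β∈𝒞̄ : pt β ∈ closure (𝒞 Φ)
    β∈𝒞̄ = ⊆-closure (λ i → CommutativeRing.refl (CompleteOrderedField.commutativeRing ℝ)) (derivable⇒∈ ⊢Φ)
    contradict : ¬ Derivable ΠrbΦ
    contradict (m , m≢0 , ⊢rb) = ⊬rb m m≢0 ⊢rb
    refute : pt β ∉ rb𝒞 Φ
    refute β∈rb = contradict (∈⇒implication (relativeBoundary-closed 𝒞-closed) β rb-axiom β-axiom β∈rb)
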